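{- Let $n$ be a positive integer and $0\le k\le n$. Let $\mathrm{RInc}_k(2\times n)$ be the set of $2\times n$ arrays $T=(T_{i,j})_{1\le i\le 2,\,1\le j\le n}$ of positive integers such that each row is strictly increasing from left to right, each column is weakly increasing from top to bottom ($T_{1,j}\le T_{2,j}$), and the set of entries of $T$ is exactly $\{1,2,\ldots,2n-k\}$. Then \[ \sum_{T\in \mathrm{RInc}_k(2\times n)} q^{\mathrm{maj}(T)}=\frac{q^{\,n+k(k-3)/2}}{[n-k+1]}\begin{bmatrix}2n-k\\ k\end{bmatrix}\begin{bmatrix}2n-2k\\ n-k\end{bmatrix}. \]
   Context: Rows are numbered from top (row 1) to bottom (row 2). For such a two-row array $T$, an integer $i$ is a descent of $T$ if $i$ occurs in row 1 and $i+1$ occurs in row 2; $D(T)$ is the set of descents and $\mathrm{maj}(T)=\sum_{i\in D(T)} i$. Here $[m]=1+q+\cdots+q^{m-1}$, $[m]!=[1][2]\cdots[m]$, and $\begin{bmatrix}a\\ b\end{bmatrix}=\frac{[a]!}{[b]![a-b]!}$ is the $q$-binomial coefficient. -}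

module Defs where

open import Data.Nat using (ℕ; zero; suc; _+_; _*_; _∸_; _≤_; _<_; _≤?_; _<?_; _≟_)
open import Data.Nat.DivMod using (_/_)
open import Data.Fin as F using (Fin; toℕ)
open import Data.Fin.Properties using (all?; any?)
open import Data.Product using (Σ; ∃; ∃-syntax; _×_; _,_)
open import Data.List using (List; []; _∷_; map; concatMap; filter; foldr; replicate; upTo)
open import Data.Bool using (if_then_else_)
open import Relation.Binary.PropositionalEquality using (_≡_)
open import Relation.Nullary using (Dec; does)
open import Relation.Nullary.Decidable using (_×-dec_; _→-dec_)
open import Relation.Unary using (Decidable)

-- Polynomials in q with natural coefficients, as coefficient lists
-- (head = coefficient of q^0).

Poly : Set
Poly = List ℕ

coeff : Poly → ℕ → ℕ
coeff []       _       = 0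
coeff (a ∷ p)  zero    = a
coeff (a ∷ p)  (suc i) = coeff p i

infixl 6 _⊕_
infixl 7 _⊗_
infix 4 _≈ₚ_

_⊕_ : Poly → Poly → Poly
[]      ⊕ q       = q
(a ∷ p) ⊕ []      = a ∷ p
(a ∷ p) ⊕ (b ∷ q) = (a + b) ∷ (p ⊕ q)

_⊗_ : Poly → Poly → Poly
[]      ⊗ q = []
(a ∷ p) ⊗ q = map (a *_) q ⊕ (0 ∷ (p ⊗ q))

_≈ₚ_ : Poly → Poly → Set
p ≈ₚ q = ∀ i → coeff p i ≡ coeff q i

qpow : ℕ → Poly
qpow zero    = 1 ∷ []
qpow (suc m) = 0 ∷ qpow m

qint : ℕ → Poly
qint m = replicate m 1

qfact : ℕ → Poly
qfact zero    = 1 ∷ []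
qfact (suc m) = qfact m ⊗ qint (suc m)

Array : ℕ → Set
Array n = Fin 2 → Fin n → ℕ

row1 row2 : Fin 2
row1 = F.zero
row2 = F.suc F.zero

IsRInc : (n k : ℕ) → Array n → Set
IsRInc n k T =
  (∀ (r : Fin 2) (j j' : Fin n) → j F.< j' → T r j < T r j')
  × (∀ (j : Fin n) → T row1 j ≤ T row2 j)
  × (∀ (r : Fin 2) (j : Fin n) → 1 ≤ T r j × T r j ≤ (2 * n ∸ k))
  × (∀ (x : Fin (2 * n ∸ k)) → ∃[ r ] ∃[ j ] T r j ≡ suc (toℕ x))

isRInc? : (n k : ℕ) → Decidable (IsRInc n k)
isRInc? n k T =
  all? (λ r → all? (λ j → all? (λ j' → (j F.<? j') →-dec (T r j <? T r j'))))
  ×-dec all? (λ j → T row1 j ≤? T row2 j)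
  ×-dec all? (λ r → all? (λ j → (1 ≤? T r j) ×-dec (T r j ≤? (2 * n ∸ k))))
  ×-dec all? (λ x → any? (λ r → any? (λ j → T r j ≟ suc (toℕ x))))

Occurs : {n : ℕ} → Array n → Fin 2 → ℕ → Set
Occurs T r i = ∃[ j ] T r j ≡ i

occurs? : {n : ℕ} (T : Array n) (r : Fin 2) (i : ℕ) → Dec (Occurs T r i)
occurs? T r i = any? (λ j → T r j ≟ i)

IsDescent : {n : ℕ} → Array n → ℕ → Set
IsDescent T i = Occurs T row1 i × Occurs T row2 (suc i)

isDescent? : {n : ℕ} (T : Array n) (i : ℕ) → Dec (IsDescent T i)
isDescent? T i = occurs? T row1 i ×-dec occurs? T row2 (suc i)

-- maj(T) = sum of the descents of T.  Descents are entries of T, so for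
-- T ∈ RInc_k(2×n) they lie in {1..N}; we sum over i = 1..N.
maj : (n k : ℕ) → Array n → ℕ
maj n k T = foldr (λ i s → (if does (isDescent? T i) then i else 0) + s) 0
                  (map suc (upTo (2 * n ∸ k)))

-- Enumeration of RInc_k(2×n): all arrays with entries in {1..N} (a finite
-- superset, each array listed exactly once), filtered by IsRInc.

allFuns : (m : ℕ) → List ℕ → List (Fin m → ℕ)
allFuns zero    vs = (λ ()) ∷ []
allFuns (suc m) vs =
  concatMap (λ v → map (λ f → λ { F.zero → v ; (F.suc j) → f j }) (allFuns m vs)) vs

allArrays : (n N : ℕ) → List (Array n)
allArrays n N =
  concatMap (λ a → map (λ b → λ { F.zero → a ; (F.suc F.zero) → b }) rows) rows
  where rows = allFuns n (map suc (upTo N))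

RInc : (n k : ℕ) → List (Array n)
RInc n k = filter (isRInc? n k) (allArrays n (2 * n ∸ k))

majGF : (n k : ℕ) → Poly
majGF n k = foldr (λ T s → qpow (maj n k T) ⊕ s) [] (RInc n k)

-- q-binomial [a choose b] is [a]!/([b]![a-b]!); we keep numerator and
-- denominator separately so that no polynomial division is needed.

-- the exponent n + k(k-3)/2 (always a nonnegative integer for k ≤ n;
-- k(k-3) is even)
expo : (n k : ℕ) → ℕ
expo n k = (2 * n + k * k ∸ 3 * k) / 2

{-# OPTIONS --safe #-}
module Submission where

-- Reading the values 1, …, 2n - k in order and recording which rows contain each of them turns an
-- array into a Motzkin word with letters U (top row only), D (bottom row only) and B (both rows);
-- the column condition becomes the ballot condition, and i is a descent when letter i is U or B and
-- letter i + 1 is B or D.  Let G be the maj-generating function of the ballot words with k letters B,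
-- b letters D and d + b letters U, and H the one for the same words followed by an extra D.
-- Deleting the last letter gives a closed system of recursions for G and H.  With M = d + 2b it is
-- solved, by the two q-Pascal rules, by
--   G = q^(k(k-1)/2) [M + k choose k] g,    H = q^(k(k+1)/2) [M + k choose k] h,
-- where g and h are the values at k = 0 (this is the shuffle theorem for inserting the letters B),
-- and g and h are in turn given by
--   [d+b+1]! [b]! g = q^b [d+1] [M]!,    [d+b+1]! [b]! h = q^(d+b) (1 + q^(b+1) [d]) [M]!.
-- The theorem is the case d = 0, b = n - k.

open import Defs
open import Algebra.Bundles using (CommutativeSemiring)
open import Data.Bool using (Bool; true; false; if_then_else_; _∧_)
open import Data.Empty using (⊥-elim)
open import Data.Fin as F using (Fin; toℕ; fromℕ<)
open import Data.Fin.Properties using (all?; toℕ-fromℕ<; toℕ<n)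
open import Data.List using (List; []; _∷_; _++_; _∷ʳ_; length; map; concatMap; filter; foldr; reverse; tabulate; upTo; downFrom)
open import Data.List.Membership.Propositional using (_∈_; _∉_)
open import Data.List.Membership.Propositional.Properties using (∈-map⁻; ∈-downFrom⁻; ∈-tabulate⁺; ∈-tabulate⁻)
open import Data.List.Properties using (unfold-reverse; reverse-involutive; reverse-upTo; ++-assoc; length-++; length-map; map-cong)
open import Data.List.Relation.Binary.Permutation.Propositional as ↭ using (_↭_; ↭-sym; ↭-trans; ↭-reflexive)
open import Data.List.Relation.Binary.Permutation.Propositional.Properties using (↭-reverse; All-resp-↭; map⁺)
open import Data.List.Relation.Binary.Pointwise as Pointwise using (Pointwise; []; _∷_)
open import Data.List.Relation.Unary.All as All using (All; []; _∷_)
import Data.List.Relation.Unary.All.Properties as All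
open import Data.List.Relation.Unary.AllPairs using (AllPairs; []; _∷_; allPairs?)
import Data.List.Relation.Unary.AllPairs.Properties as AllPairs
open import Data.List.Relation.Unary.Any using (here; there)
import Data.List.Relation.Unary.Any.Properties as Any
open import Data.Nat using (ℕ; zero; suc; _+_; _*_; _∸_; _≤_; _<_; _>_; _≟_; _≤?_; _>?_; _≡ᵇ_; z≤n; s≤s)
open import Data.Nat.DivMod using (_/_; m*n/n≡m)
open import Data.Nat.ListAction using (sum)
open import Data.Nat.ListAction.Properties using (sum-↭)
import Data.Nat.Properties as ℕ
open import Data.Nat.Tactic.RingSolver using (solve-∀)
open import Data.List.Membership.DecPropositional ℕ._≟_ using (_∈?_)
open import Data.Product using (_×_; _,_; ∃₂; proj₁; proj₂; ∃-syntax)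
open import Data.Sum using (_⊎_; inj₁; inj₂)
open import Function using (_∘_; flip; _⇔_; mk⇔; module Equivalence)
open import Level using (0ℓ)
open import Relation.Binary.Core using (Rel)
open import Relation.Binary.PropositionalEquality using (_≡_; refl; sym; trans; cong; cong₂; subst; subst₂; module ≡-Reasoning)
open import Relation.Binary.Structures using (IsEquivalence)
open import Relation.Nullary using (¬_; Dec; yes; no; does)
open import Relation.Nullary.Decidable using (map′; _×-dec_; _⊎-dec_; does-⇔; dec-true; dec-false)
open import Relation.Unary using (Decidable; Pred)

-- The commutative semiring of polynomials

coeff-⊕ : ∀ p r i → coeff (p ⊕ r) i ≡ coeff p i + coeff r i
coeff-⊕ []      r       i       = refl
coeff-⊕ (a ∷ p) []      i       = sym (ℕ.+-identityʳ _)
coeff-⊕ (a ∷ p) (b ∷ r) zero    = refl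
coeff-⊕ (a ∷ p) (b ∷ r) (suc i) = coeff-⊕ p r i

coeff-map-* : ∀ a p i → coeff (map (a *_) p) i ≡ a * coeff p i
coeff-map-* a []      i       = sym (ℕ.*-zeroʳ a)
coeff-map-* a (b ∷ p) zero    = refl
coeff-map-* a (b ∷ p) (suc i) = coeff-map-* a p i

-- The Cauchy product of coefficient sequences. The product laws are proved for sequences because on
-- lists they hold only up to trailing zeros: for nonempty `p`, `p ⊗ []` is a list of zeros and not
-- `[]`.
conv : (ℕ → ℕ) → (ℕ → ℕ) → ℕ → ℕ
conv f g zero    = f 0 * g 0
conv f g (suc i) = f 0 * g (suc i) + conv (λ j → f (suc j)) g i

conv-cong : ∀ {f f′ g g′} → (∀ i → f i ≡ f′ i) → (∀ i → g i ≡ g′ i) → ∀ i → conv f g i ≡ conv f′ g′ i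
conv-cong ff gg zero    = cong₂ _*_ (ff 0) (gg 0)
conv-cong ff gg (suc i) = cong₂ _+_ (cong₂ _*_ (ff 0) (gg (suc i))) (conv-cong (λ j → ff (suc j)) gg i)

conv-zeroˡ : ∀ g i → conv (λ _ → 0) g i ≡ 0
conv-zeroˡ g zero    = refl
conv-zeroˡ g (suc i) = conv-zeroˡ g i

-- `conv` recurses on its first argument; peeling off the second one as well is what makes
-- commutativity a plain induction.
conv-sucʳ : ∀ f g i → conv f g (suc i) ≡ f (suc i) * g 0 + conv f (λ j → g (suc j)) i
conv-sucʳ f g zero    = ℕ.+-comm (f 0 * g 1) _
conv-sucʳ f g (suc i) = trans
  (cong (f 0 * g (suc (suc i)) +_) (conv-sucʳ (λ j → f (suc j)) g i))
  (swap (f 0 * g (suc (suc i))) (f (suc (suc i)) * g 0) _)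
  where
  swap : ∀ x y z → x + (y + z) ≡ y + (x + z)
  swap = solve-∀

conv-comm : ∀ f g i → conv f g i ≡ conv g f i
conv-comm f g zero    = ℕ.*-comm (f 0) (g 0)
conv-comm f g (suc i) = trans (cong₂ _+_ (ℕ.*-comm (f 0) (g (suc i))) (conv-comm (λ j → f (suc j)) g i))
                              (sym (conv-sucʳ g f i))

conv-distribʳ : ∀ f g h i → conv (λ j → f j + g j) h i ≡ conv f h i + conv g h i
conv-distribʳ f g h zero    = ℕ.*-distribʳ-+ (h 0) (f 0) (g 0)
conv-distribʳ f g h (suc i) = trans
  (cong ((f 0 + g 0) * h (suc i) +_) (conv-distribʳ (λ j → f (suc j)) (λ j → g (suc j)) h i))
  (arith (f 0) (g 0) (h (suc i)) _ _)
  where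
  arith : ∀ x y z u v → (x + y) * z + (u + v) ≡ x * z + u + (y * z + v)
  arith = solve-∀

conv-scaleˡ : ∀ a f g i → conv (λ j → a * f j) g i ≡ a * conv f g i
conv-scaleˡ a f g zero    = ℕ.*-assoc a (f 0) (g 0)
conv-scaleˡ a f g (suc i) = trans
  (cong₂ _+_ (ℕ.*-assoc a (f 0) (g (suc i))) (conv-scaleˡ a (λ j → f (suc j)) g i))
  (sym (ℕ.*-distribˡ-+ a (f 0 * g (suc i)) _))

conv-assoc : ∀ f g h i → conv (conv f g) h i ≡ conv f (conv g h) i
conv-assoc f g h zero    = ℕ.*-assoc (f 0) (g 0) (h 0)
conv-assoc f g h (suc i) = begin
  f 0 * g 0 * h (suc i) + conv (λ j → f 0 * g (suc j) + conv f′ g j) h i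
    ≡⟨ cong (f 0 * g 0 * h (suc i) +_) (conv-distribʳ (λ j → f 0 * g (suc j)) (conv f′ g) h i) ⟩
  f 0 * g 0 * h (suc i) + (conv (λ j → f 0 * g (suc j)) h i + conv (conv f′ g) h i)
    ≡⟨ cong (f 0 * g 0 * h (suc i) +_) (cong₂ _+_ (conv-scaleˡ (f 0) (λ j → g (suc j)) h i) (conv-assoc f′ g h i)) ⟩
  f 0 * g 0 * h (suc i) + (f 0 * conv (λ j → g (suc j)) h i + conv f′ (conv g h) i)
    ≡⟨ arith (f 0) (g 0) (h (suc i)) _ _ ⟩
  f 0 * (g 0 * h (suc i) + conv (λ j → g (suc j)) h i) + conv f′ (conv g h) i ∎
  where
  open ≡-Reasoning
  f′ = λ j → f (suc j)
  arith : ∀ x y z u v → x * y * z + (x * u + v) ≡ x * (y * z + u) + v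
  arith = solve-∀

coeff-⊗ : ∀ p r i → coeff (p ⊗ r) i ≡ conv (coeff p) (coeff r) i
coeff-⊗ []      r i       = sym (conv-zeroˡ (coeff r) i)
coeff-⊗ (a ∷ p) r zero    = trans (coeff-⊕ (map (a *_) r) (0 ∷ (p ⊗ r)) 0)
                                  (trans (ℕ.+-identityʳ _) (coeff-map-* a r 0))
coeff-⊗ (a ∷ p) r (suc i) = trans (coeff-⊕ (map (a *_) r) (0 ∷ (p ⊗ r)) (suc i))
                                  (cong₂ _+_ (coeff-map-* a r (suc i)) (coeff-⊗ p r i))

-- A record around _≈ₚ_, which unfolds to a Π-type from which Agda cannot recover the polynomials.
infix 4 _≋_
record _≋_ (p r : Poly) : Set where
  constructor mk≋
  field coeff≡ : p ≈ₚ r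
open _≋_

𝟙 : Poly
𝟙 = 1 ∷ []

⊕-≋-cong : ∀ {p p′ r r′} → p ≋ p′ → r ≋ r′ → p ⊕ r ≋ p′ ⊕ r′
⊕-≋-cong {p} {p′} {r} {r′} e f = mk≋ λ i →
  trans (coeff-⊕ p r i) (trans (cong₂ _+_ (coeff≡ e i) (coeff≡ f i)) (sym (coeff-⊕ p′ r′ i)))

⊗-≋-cong : ∀ {p p′ r r′} → p ≋ p′ → r ≋ r′ → p ⊗ r ≋ p′ ⊗ r′
⊗-≋-cong {p} {p′} {r} {r′} e f = mk≋ λ i →
  trans (coeff-⊗ p r i) (trans (conv-cong (coeff≡ e) (coeff≡ f) i) (sym (coeff-⊗ p′ r′ i)))

⊕-comm : ∀ p r → p ⊕ r ≡ r ⊕ p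
⊕-comm []      []      = refl
⊕-comm []      (b ∷ r) = refl
⊕-comm (a ∷ p) []      = refl
⊕-comm (a ∷ p) (b ∷ r) = cong₂ _∷_ (ℕ.+-comm a b) (⊕-comm p r)

⊕-identityʳ : ∀ p → p ⊕ [] ≡ p
⊕-identityʳ p = ⊕-comm p []

⊕-assoc : ∀ p r s → (p ⊕ r) ⊕ s ≡ p ⊕ (r ⊕ s)
⊕-assoc []      r       s       = refl
⊕-assoc (a ∷ p) []      s       = refl
⊕-assoc (a ∷ p) (b ∷ r) []      = refl
⊕-assoc (a ∷ p) (b ∷ r) (c ∷ s) = cong₂ _∷_ (ℕ.+-assoc a b c) (⊕-assoc p r s)

≡⇒≋ : ∀ {p r} → p ≡ r → p ≋ r
≡⇒≋ refl = mk≋ λ _ → refl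

⊗-comm : ∀ p r → p ⊗ r ≋ r ⊗ p
⊗-comm p r = mk≋ λ i → trans (coeff-⊗ p r i) (trans (conv-comm (coeff p) (coeff r) i) (sym (coeff-⊗ r p i)))

⊗-assoc : ∀ p r s → (p ⊗ r) ⊗ s ≋ p ⊗ (r ⊗ s)
⊗-assoc p r s = mk≋ λ i → begin
  coeff ((p ⊗ r) ⊗ s) i                       ≡⟨ coeff-⊗ (p ⊗ r) s i ⟩
  conv (coeff (p ⊗ r)) (coeff s) i            ≡⟨ conv-cong (coeff-⊗ p r) (λ _ → refl) i ⟩
  conv (conv (coeff p) (coeff r)) (coeff s) i ≡⟨ conv-assoc (coeff p) (coeff r) (coeff s) i ⟩
  conv (coeff p) (conv (coeff r) (coeff s)) i ≡⟨ conv-cong {f = coeff p} (λ _ → refl) (coeff-⊗ r s) i ⟨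
  conv (coeff p) (coeff (r ⊗ s)) i            ≡⟨ coeff-⊗ p (r ⊗ s) i ⟨
  coeff (p ⊗ (r ⊗ s)) i                       ∎
  where open ≡-Reasoning

⊗-distribʳ : ∀ s p r → (p ⊕ r) ⊗ s ≋ (p ⊗ s) ⊕ (r ⊗ s)
⊗-distribʳ s p r = mk≋ λ i → begin
  coeff ((p ⊕ r) ⊗ s) i                                       ≡⟨ coeff-⊗ (p ⊕ r) s i ⟩
  conv (coeff (p ⊕ r)) (coeff s) i                            ≡⟨ conv-cong (coeff-⊕ p r) (λ _ → refl) i ⟩
  conv (λ j → coeff p j + coeff r j) (coeff s) i              ≡⟨ conv-distribʳ (coeff p) (coeff r) (coeff s) i ⟩
  conv (coeff p) (coeff s) i + conv (coeff r) (coeff s) i     ≡⟨ cong₂ _+_ (coeff-⊗ p s i) (coeff-⊗ r s i) ⟨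
  coeff (p ⊗ s) i + coeff (r ⊗ s) i                           ≡⟨ coeff-⊕ (p ⊗ s) (r ⊗ s) i ⟨
  coeff ((p ⊗ s) ⊕ (r ⊗ s)) i                                 ∎
  where open ≡-Reasoning

⊗-identityˡ : ∀ p → 𝟙 ⊗ p ≋ p
⊗-identityˡ p = mk≋ λ i → trans (coeff-⊗ 𝟙 p i) (unit i)
  where
  unit : ∀ i → conv (coeff 𝟙) (coeff p) i ≡ coeff p i
  unit zero    = ℕ.*-identityˡ _
  unit (suc i) = trans (cong₂ _+_ (ℕ.*-identityˡ _) (conv-zeroˡ (coeff p) i)) (ℕ.+-identityʳ _)

open import Algebra.Structures.Biased _≋_ using (isCommutativeSemiringˡ)

polySemiring : CommutativeSemiring 0ℓ 0ℓ
polySemiring = record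
  { Carrier = Poly ; _≈_ = _≋_ ; _+_ = _⊕_ ; _*_ = _⊗_ ; 0# = [] ; 1# = 𝟙
  ; isCommutativeSemiring = isCommutativeSemiringˡ record
    { +-isCommutativeMonoid = record
      { isMonoid = record
        { isSemigroup = record
          { isMagma = record { isEquivalence = ≋-isEquivalence ; ∙-cong = ⊕-≋-cong }
          ; assoc = λ p r s → ≡⇒≋ (⊕-assoc p r s) }
        ; identity = (λ _ → ≡⇒≋ refl) , λ p → ≡⇒≋ (⊕-identityʳ p) }
      ; comm = λ p r → ≡⇒≋ (⊕-comm p r) }
    ; *-isCommutativeMonoid = record
      { isMonoid = record
        { isSemigroup = record
          { isMagma = record { isEquivalence = ≋-isEquivalence ; ∙-cong = ⊗-≋-cong }
          ; assoc = ⊗-assoc }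
        ; identity = ⊗-identityˡ , λ p → ≋-trans (⊗-comm p 𝟙) (⊗-identityˡ p) }
      ; comm = ⊗-comm }
    ; distribʳ = ⊗-distribʳ
    ; zeroˡ = λ _ → ≡⇒≋ refl } }
  where
  ≋-trans : ∀ {p r s} → p ≋ r → r ≋ s → p ≋ s
  ≋-trans e f = mk≋ λ i → trans (coeff≡ e i) (coeff≡ f i)
  ≋-isEquivalence : IsEquivalence _≋_
  ≋-isEquivalence = record
    { refl = ≡⇒≋ refl ; sym = λ e → mk≋ λ i → sym (coeff≡ e i) ; trans = ≋-trans }

open CommutativeSemiring polySemiring using (setoid)
  renaming (refl to ≋-refl; sym to ≋-sym; trans to ≋-trans; zeroʳ to ⊗-zeroʳ; distribˡ to ⊗-distribˡ)
import Relation.Binary.Reasoning.Setoid setoid as ≋-Reasoning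
open import Algebra.Solver.Ring.NaturalCoefficients.Default polySemiring using (solve; con; _:+_; _:*_; _:=_)

-- q-integers and q-binomial coefficients

q : Poly
q = qpow 1

∷-⊗ : ∀ p r → (0 ∷ p) ⊗ r ≋ 0 ∷ (p ⊗ r)
∷-⊗ p r = mk≋ λ i → trans (coeff-⊕ (map (0 *_) r) (0 ∷ (p ⊗ r)) i)
                          (cong (_+ coeff (0 ∷ (p ⊗ r)) i) (coeff-map-* 0 r i))

∷-cong : ∀ {p r} → p ≋ r → 0 ∷ p ≋ 0 ∷ r
∷-cong e = mk≋ λ { zero → refl ; (suc i) → coeff≡ e i }

∷≋q⊗ : ∀ p → 0 ∷ p ≋ q ⊗ p
∷≋q⊗ p = ≋-sym (≋-trans (∷-⊗ 𝟙 p) (∷-cong (⊗-identityˡ p)))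

qpow-suc : ∀ a → qpow (suc a) ≋ q ⊗ qpow a
qpow-suc a = ∷≋q⊗ (qpow a)

qpow-+ : ∀ a b → qpow (a + b) ≋ qpow a ⊗ qpow b
qpow-+ zero    b = ≋-sym (⊗-identityˡ (qpow b))
qpow-+ (suc a) b = ≋-trans (∷-cong (qpow-+ a b)) (≋-sym (∷-⊗ (qpow a) (qpow b)))

qint-suc : ∀ a → qint (suc a) ≋ 𝟙 ⊕ q ⊗ qint a
qint-suc a = ⊕-≋-cong (≋-refl {𝟙}) (∷≋q⊗ (qint a))

qint-+ : ∀ a b → qint (a + b) ≋ qint a ⊕ qpow a ⊗ qint b
qint-+ zero    b = ≋-sym (⊗-identityˡ (qint b))
qint-+ (suc a) b = begin
  qint (suc a + b)                                      ≈⟨ qint-suc (a + b) ⟩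
  𝟙 ⊕ q ⊗ qint (a + b)                                  ≈⟨ ⊕-≋-cong (≋-refl {𝟙}) (⊗-≋-cong (≋-refl {q}) (qint-+ a b)) ⟩
  𝟙 ⊕ q ⊗ (qint a ⊕ qpow a ⊗ qint b)
    ≈⟨ solve 4 (λ t x y z → con 1 :+ t :* (x :+ y :* z) := (con 1 :+ t :* x) :+ (t :* y) :* z) ≋-refl
         q (qint a) (qpow a) (qint b) ⟩
  (𝟙 ⊕ q ⊗ qint a) ⊕ (q ⊗ qpow a) ⊗ qint b
    ≈⟨ ⊕-≋-cong (qint-suc a) (⊗-≋-cong (qpow-suc a) (≋-refl {qint b})) ⟨
  qint (suc a) ⊕ qpow (suc a) ⊗ qint b                  ∎
  where open ≋-Reasoning

qint-suc′ : ∀ a → qint (suc a) ≋ qint a ⊕ qpow a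
qint-suc′ a = begin
  qint (suc a)                 ≡⟨ cong qint (ℕ.+-comm 1 a) ⟩
  qint (a + 1)                 ≈⟨ qint-+ a 1 ⟩
  qint a ⊕ qpow a ⊗ 𝟙          ≈⟨ solve 2 (λ x y → x :+ y :* con 1 := x :+ y) ≋-refl (qint a) (qpow a) ⟩
  qint a ⊕ qpow a              ∎
  where open ≋-Reasoning

-- qbin i j is the q-binomial coefficient [i + j choose i].
qbin : ℕ → ℕ → Poly
qbin zero    j       = 𝟙
qbin (suc i) zero    = 𝟙
qbin (suc i) (suc j) = qbin (suc i) j ⊕ qpow (suc j) ⊗ qbin i (suc j)

-- The second Pascal rule, `qbin` being defined by the first. In the general case induction on both
-- summands leaves the three q-binomials `x`, `y`, `z`, which the defining rule regroups.
qbin-pascal : ∀ i j → qbin (suc i) (suc j) ≋ qpow (suc i) ⊗ qbin (suc i) j ⊕ qbin i (suc j)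
qbin-pascal zero zero = ≡⇒≋ refl
qbin-pascal zero (suc j) = begin
  qbin 1 (suc j) ⊕ qpow (suc (suc j)) ⊗ 𝟙
    ≈⟨ ⊕-≋-cong (qbin-pascal 0 j) (⊗-≋-cong (qpow-suc (suc j)) (≋-refl {𝟙})) ⟩
  (q ⊗ qbin 1 j ⊕ 𝟙) ⊕ (q ⊗ qpow (suc j)) ⊗ 𝟙
    ≈⟨ solve 3 (λ t x y → (t :* x :+ con 1) :+ (t :* y) :* con 1 := t :* (x :+ y :* con 1) :+ con 1) ≋-refl
         q (qbin 1 j) (qpow (suc j)) ⟩
  q ⊗ (qbin 1 j ⊕ qpow (suc j) ⊗ 𝟙) ⊕ 𝟙 ∎
  where open ≋-Reasoning
qbin-pascal (suc i) zero = begin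
  𝟙 ⊕ q ⊗ qbin (suc i) 1
    ≈⟨ ⊕-≋-cong (≋-refl {𝟙}) (⊗-≋-cong (≋-refl {q}) (qbin-pascal i 0)) ⟩
  𝟙 ⊕ q ⊗ (qpow (suc i) ⊗ 𝟙 ⊕ qbin i 1)
    ≈⟨ solve 3 (λ t x y → con 1 :+ t :* (x :* con 1 :+ y) := (t :* x) :* con 1 :+ (con 1 :+ t :* y)) ≋-refl
         q (qpow (suc i)) (qbin i 1) ⟩
  (q ⊗ qpow (suc i)) ⊗ 𝟙 ⊕ (𝟙 ⊕ q ⊗ qbin i 1)
    ≈⟨ ⊕-≋-cong (⊗-≋-cong (qpow-suc (suc i)) (≋-refl {𝟙})) (≋-refl {𝟙 ⊕ q ⊗ qbin i 1}) ⟨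
  qpow (suc (suc i)) ⊗ 𝟙 ⊕ qbin (suc i) 1 ∎
  where open ≋-Reasoning
qbin-pascal (suc i) (suc j) = begin
  qbin (suc (suc i)) (suc j) ⊕ qpow (suc (suc j)) ⊗ qbin (suc i) (suc (suc j))
    ≈⟨ ⊕-≋-cong (qbin-pascal (suc i) j) (⊗-≋-cong (qpow-suc (suc j)) (qbin-pascal i (suc j))) ⟩
  (qpow (suc (suc i)) ⊗ x ⊕ y) ⊕ (q ⊗ qj) ⊗ (qi ⊗ y ⊕ z)
    ≈⟨ ⊕-≋-cong (⊕-≋-cong (⊗-≋-cong (qpow-suc (suc i)) (≋-refl {x})) (≋-refl {y})) (≋-refl {(q ⊗ qj) ⊗ (qi ⊗ y ⊕ z)}) ⟩
  ((q ⊗ qi) ⊗ x ⊕ y) ⊕ (q ⊗ qj) ⊗ (qi ⊗ y ⊕ z)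
    ≈⟨ solve 6 (λ t i j x y z → (((t :* i) :* x) :+ y) :+ (t :* j) :* (i :* y :+ z)
                             := (t :* i) :* (x :+ j :* y) :+ (y :+ (t :* j) :* z)) ≋-refl
         q qi qj x y z ⟩
  (q ⊗ qi) ⊗ (x ⊕ qj ⊗ y) ⊕ (y ⊕ (q ⊗ qj) ⊗ z)
    ≈⟨ ⊕-≋-cong (⊗-≋-cong (qpow-suc (suc i)) (≋-refl {x ⊕ qj ⊗ y}))
                (⊕-≋-cong (≋-refl {y}) (⊗-≋-cong (qpow-suc (suc j)) (≋-refl {z}))) ⟨
  qpow (suc (suc i)) ⊗ qbin (suc (suc i)) (suc j) ⊕ qbin (suc i) (suc (suc j)) ∎
  where
  open ≋-Reasoning
  x = qbin (suc (suc i)) j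
  y = qbin (suc i) (suc j)
  z = qbin i (suc (suc j))
  qi = qpow (suc i)
  qj = qpow (suc j)

-- Ties the recursive `qbin` to factorials without division. The two Pascal summands share the
-- factor `qfact (i + suc j)` and leave [j+1] + q^(j+1) [i+1] = [i+j+2].
qfact-qbin : ∀ i j → (qfact i ⊗ qfact j) ⊗ qbin i j ≋ qfact (i + j)
qfact-qbin zero j = solve 1 (λ x → (con 1 :* x) :* con 1 := x) ≋-refl (qfact j)
qfact-qbin (suc i) zero = begin
  (qfact (suc i) ⊗ 𝟙) ⊗ 𝟙  ≈⟨ solve 1 (λ x → (x :* con 1) :* con 1 := x) ≋-refl (qfact (suc i)) ⟩
  qfact (suc i)            ≡⟨ cong qfact (ℕ.+-identityʳ (suc i)) ⟨
  qfact (suc i + 0)        ∎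
  where open ≋-Reasoning
qfact-qbin (suc i) (suc j) = begin
  ((fi ⊗ qi) ⊗ (fj ⊗ qj)) ⊗ (x ⊕ t ⊗ y)
    ≈⟨ solve 7 (λ fi qi fj qj x t y → ((fi :* qi) :* (fj :* qj)) :* (x :+ t :* y)
          := qj :* (((fi :* qi) :* fj) :* x) :+ (t :* qi) :* ((fi :* (fj :* qj)) :* y)) ≋-refl
         fi qi fj qj x t y ⟩
  qj ⊗ (((fi ⊗ qi) ⊗ fj) ⊗ x) ⊕ (t ⊗ qi) ⊗ ((fi ⊗ (fj ⊗ qj)) ⊗ y)
    ≈⟨ ⊕-≋-cong (⊗-≋-cong (≋-refl {qj}) (qfact-qbin (suc i) j))
                (⊗-≋-cong (≋-refl {t ⊗ qi}) (qfact-qbin i (suc j))) ⟩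
  qj ⊗ qfact (suc i + j) ⊕ (t ⊗ qi) ⊗ qfact (i + suc j)
    ≡⟨ cong (λ n → qj ⊗ qfact n ⊕ (t ⊗ qi) ⊗ qfact (i + suc j)) (sym (ℕ.+-suc i j)) ⟩
  qj ⊗ f ⊕ (t ⊗ qi) ⊗ f
    ≈⟨ solve 4 (λ qj f t qi → qj :* f :+ (t :* qi) :* f := f :* (qj :+ t :* qi)) ≋-refl qj f t qi ⟩
  f ⊗ (qj ⊕ t ⊗ qi)
    ≈⟨ ⊗-≋-cong (≋-refl {f}) (qint-+ (suc j) (suc i)) ⟨
  f ⊗ qint (suc j + suc i)
    ≡⟨ cong (λ n → f ⊗ qint n) (ℕ.+-comm (suc j) (suc i)) ⟩
  qfact (suc i + suc j) ∎
  where
  open ≋-Reasoning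
  fi = qfact i
  fj = qfact j
  qi = qint (suc i)
  qj = qint (suc j)
  x  = qbin (suc i) j
  y  = qbin i (suc j)
  t  = qpow (suc j)
  f  = qfact (i + suc j)

-- Ballot words without the letter B

-- ballot d b is the maj-generating function of ballot words with d + b up-steps and b down-steps;
-- ballotD d b is the same with a further down-step appended to each word.
mutual
  ballot : ℕ → ℕ → Poly
  ballot zero    zero    = 𝟙
  ballot (suc d) zero    = ballotUp (suc d) zero ⊕ ballotDn (suc d) zero
  ballot d       (suc b) = ballotUp d (suc b) ⊕ ballotDn d (suc b)

  ballotD : ℕ → ℕ → Poly
  ballotD zero    zero    = 𝟙
  ballotD (suc d) zero    = ballotDn (suc d) zero ⊕ qpow (suc d + 0) ⊗ ballotUp (suc d) zero
  ballotD d       (suc b) = ballotDn d (suc b) ⊕ qpow (d + (suc b + suc b)) ⊗ ballotUp d (suc b)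

  ballotUp : ℕ → ℕ → Poly
  ballotUp zero    b = []
  ballotUp (suc d) b = ballot d b

  ballotDn : ℕ → ℕ → Poly
  ballotDn d zero    = []
  ballotDn d (suc b) = ballotD (suc d) b

-- Deletion of the last letter. Positive length matters: at `d = b = 0` the right side is `[]`, not
-- `𝟙`.
ballot-rec : ∀ d b {m} → d + (b + b) ≡ suc m → ballot d b ≡ ballotUp d b ⊕ ballotDn d b
ballot-rec (suc d) zero    e = refl
ballot-rec zero    (suc b) e = refl
ballot-rec (suc d) (suc b) e = refl

-- If the deleted letter is U, the appended D makes its position `d + (b + b)` a descent. If it is
-- D, no descent arises, and the deleted D takes over the role of the appended one.
ballotD-rec : ∀ d b {m} → d + (b + b) ≡ suc m →
              ballotD d b ≡ ballotDn d b ⊕ qpow (d + (b + b)) ⊗ ballotUp d b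
ballotD-rec (suc d) zero    e = refl
ballotD-rec zero    (suc b) e = refl
ballotD-rec (suc d) (suc b) e = refl

length-dn : ∀ d b {m} → d + (suc b + suc b) ≡ suc m → suc d + (b + b) ≡ m
length-dn d b e = ℕ.suc-injective (trans (sym (trans (ℕ.+-suc d (b + suc b)) (cong suc (trans (cong (d +_) (ℕ.+-suc b b)) (ℕ.+-suc d (b + b)))))) e)

-- What the induction steps for `ballot` and `ballotD` come down to once the common factorial is
-- split off. The q-integers are expanded by `qint-+` in [d], q^d, [b], q^b, until a semiring
-- identity remains.
module BallotIdentity (d b : ℕ) where
  open ≋-Reasoning

  private
    x = qint d
    R = qpow d
    y = qint b
    Q = qpow b
    e = qint (suc d)

  e≋ : e ≋ x ⊕ R
  e≋ = qint-suc′ d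

  top≋ : qint (suc (d + b)) ≋ y ⊕ Q ⊗ e
  top≋ = ≋-trans (≡⇒≋ (cong qint (ℕ.+-comm (suc d) b))) (qint-+ b (suc d))

  all≋ : qint (d + (b + b)) ≋ y ⊕ Q ⊗ (x ⊕ R ⊗ y)
  all≋ = begin
    qint (d + (b + b))        ≡⟨ cong qint (trans (sym (ℕ.+-assoc d b b)) (ℕ.+-comm (d + b) b)) ⟩
    qint (b + (d + b))        ≈⟨ qint-+ b (d + b) ⟩
    y ⊕ Q ⊗ qint (d + b)      ≈⟨ ⊕-≋-cong (≋-refl {y}) (⊗-≋-cong (≋-refl {Q}) (qint-+ d b)) ⟩
    y ⊕ Q ⊗ (x ⊕ R ⊗ y)       ∎

  -- The relation that absorbs the extra factor `q` in `ballotD-identity`.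
  suc-all≋ : 𝟙 ⊕ q ⊗ qint (d + (b + b)) ≋ y ⊕ Q ⊗ (y ⊕ Q ⊗ e)
  suc-all≋ = begin
    𝟙 ⊕ q ⊗ qint (d + (b + b))      ≈⟨ qint-suc (d + (b + b)) ⟨
    qint (suc d + (b + b))          ≡⟨ cong qint (trans (sym (ℕ.+-assoc (suc d) b b)) (ℕ.+-comm (suc d + b) b)) ⟩
    qint (b + (suc d + b))          ≈⟨ qint-+ b (suc d + b) ⟩
    y ⊕ Q ⊗ qint (suc (d + b))      ≈⟨ ⊕-≋-cong (≋-refl {y}) (⊗-≋-cong (≋-refl {Q}) top≋) ⟩
    y ⊕ Q ⊗ (y ⊕ Q ⊗ e)             ∎

  ballot-identity : qint (suc (d + b)) ⊗ (Q ⊗ x) ⊕ y ⊗ (qpow (d + b) ⊗ (𝟙 ⊕ Q ⊗ e))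
                  ≋ (Q ⊗ e) ⊗ qint (d + (b + b))
  ballot-identity = begin
    qint (suc (d + b)) ⊗ (Q ⊗ x) ⊕ y ⊗ (qpow (d + b) ⊗ (𝟙 ⊕ Q ⊗ e))
      ≈⟨ ⊕-≋-cong (⊗-≋-cong (≋-trans top≋ (⊕-≋-cong (≋-refl {y}) (⊗-≋-cong (≋-refl {Q}) e≋))) (≋-refl {Q ⊗ x}))
           (⊗-≋-cong (≋-refl {y}) (⊗-≋-cong (qpow-+ d b) (⊕-≋-cong (≋-refl {𝟙}) (⊗-≋-cong (≋-refl {Q}) e≋)))) ⟩
    (y ⊕ Q ⊗ (x ⊕ R)) ⊗ (Q ⊗ x) ⊕ y ⊗ ((R ⊗ Q) ⊗ (𝟙 ⊕ Q ⊗ (x ⊕ R)))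
      ≈⟨ solve 4 (λ x y Q R → (y :+ Q :* (x :+ R)) :* (Q :* x) :+ y :* ((R :* Q) :* (con 1 :+ Q :* (x :+ R)))
                   := (Q :* (x :+ R)) :* (y :+ Q :* (x :+ R :* y))) ≋-refl x y Q R ⟩
    (Q ⊗ (x ⊕ R)) ⊗ (y ⊕ Q ⊗ (x ⊕ R ⊗ y))
      ≈⟨ ⊗-≋-cong (⊗-≋-cong (≋-refl {Q}) e≋) all≋ ⟨
    (Q ⊗ e) ⊗ qint (d + (b + b)) ∎

  ballotD-identity : y ⊗ (qpow (d + b) ⊗ (𝟙 ⊕ Q ⊗ e)) ⊕ qpow (d + (b + b)) ⊗ (qint (suc (d + b)) ⊗ (Q ⊗ x))
                   ≋ (qpow (d + b) ⊗ (𝟙 ⊕ (q ⊗ Q) ⊗ x)) ⊗ qint (d + (b + b))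
  ballotD-identity = ≋-sym (begin
    (qpow (d + b) ⊗ (𝟙 ⊕ (q ⊗ Q) ⊗ x)) ⊗ m
      ≈⟨ solve 5 (λ A t Q x m → (A :* (con 1 :+ (t :* Q) :* x)) :* m := A :* (m :+ (Q :* x) :* (t :* m))) ≋-refl
           (qpow (d + b)) q Q x m ⟩
    qpow (d + b) ⊗ (m ⊕ (Q ⊗ x) ⊗ (q ⊗ m))
      ≈⟨ ⊗-≋-cong (≋-refl {qpow (d + b)}) (⊕-≋-cong all≋ (≋-refl {(Q ⊗ x) ⊗ (q ⊗ m)})) ⟩
    qpow (d + b) ⊗ ((y ⊕ Q ⊗ (x ⊕ R ⊗ y)) ⊕ (Q ⊗ x) ⊗ (q ⊗ m))
      -- The summand `Q ⊗ x` is moved over so that it completes `q ⊗ m` to `𝟙 ⊕ q ⊗ m`.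
      ≈⟨ solve 6 (λ A x y Q R z → A :* ((y :+ Q :* (x :+ R :* y)) :+ (Q :* x) :* z)
                    := A :* ((y :+ Q :* (R :* y)) :+ (Q :* x) :* (con 1 :+ z))) ≋-refl
           (qpow (d + b)) x y Q R (q ⊗ m) ⟩
    qpow (d + b) ⊗ ((y ⊕ Q ⊗ (R ⊗ y)) ⊕ (Q ⊗ x) ⊗ (𝟙 ⊕ q ⊗ m))
      ≈⟨ ⊗-≋-cong (≋-refl {qpow (d + b)}) (⊕-≋-cong (≋-refl {y ⊕ Q ⊗ (R ⊗ y)}) (⊗-≋-cong (≋-refl {Q ⊗ x}) suc-all≋)) ⟩
    qpow (d + b) ⊗ ((y ⊕ Q ⊗ (R ⊗ y)) ⊕ (Q ⊗ x) ⊗ (y ⊕ Q ⊗ (y ⊕ Q ⊗ e)))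
      ≈⟨ solve 6 (λ A x y Q R z → A :* ((y :+ Q :* (R :* y)) :+ (Q :* x) :* (y :+ Q :* z))
                    := y :* (A :* (con 1 :+ Q :* (x :+ R))) :+ (A :* Q) :* (z :* (Q :* x))) ≋-refl
           (qpow (d + b)) x y Q R (y ⊕ Q ⊗ e) ⟩
    y ⊗ (qpow (d + b) ⊗ (𝟙 ⊕ Q ⊗ (x ⊕ R))) ⊕ (qpow (d + b) ⊗ Q) ⊗ ((y ⊕ Q ⊗ e) ⊗ (Q ⊗ x))
      ≈⟨ ⊕-≋-cong (⊗-≋-cong (≋-refl {y}) (⊗-≋-cong (≋-refl {qpow (d + b)}) (⊕-≋-cong (≋-refl {𝟙}) (⊗-≋-cong (≋-refl {Q}) e≋))))
           (⊗-≋-cong (≋-trans (≡⇒≋ (cong qpow (sym (ℕ.+-assoc d b b)))) (qpow-+ (d + b) b)) (⊗-≋-cong top≋ (≋-refl {Q ⊗ x}))) ⟨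
    y ⊗ (qpow (d + b) ⊗ (𝟙 ⊕ Q ⊗ e)) ⊕ qpow (d + (b + b)) ⊗ (qint (suc (d + b)) ⊗ (Q ⊗ x)) ∎)
    where m = qint (d + (b + b))

mutual
  -- All four closed forms go by simultaneous induction on the length `m`. At `d = 0` this one is
  -- q^b times MacMahon's q-Catalan number [2b]! / ([b]! [b+1]!).
  ballot-closed : ∀ m d b → d + (b + b) ≡ m →
    (qfact (suc (d + b)) ⊗ qfact b) ⊗ ballot d b ≋ (qpow b ⊗ qint (suc d)) ⊗ qfact m
  ballot-closed zero    zero zero eq = ≡⇒≋ refl
  ballot-closed (suc m) d    b    eq = begin
    F ⊗ ballot d b                                ≡⟨ cong (F ⊗_) (ballot-rec d b eq) ⟩
    F ⊗ (ballotUp d b ⊕ ballotDn d b)             ≈⟨ ⊗-distribˡ F (ballotUp d b) (ballotDn d b) ⟩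
    F ⊗ ballotUp d b ⊕ F ⊗ ballotDn d b           ≈⟨ ⊕-≋-cong (ballotUp-closed m d b eq) (ballotDn-closed m d b eq) ⟩
    u ⊗ qfact m ⊕ v ⊗ qfact m                     ≈⟨ ⊗-distribʳ (qfact m) u v ⟨
    (u ⊕ v) ⊗ qfact m                             ≈⟨ ⊗-≋-cong ballot-identity (≋-refl {qfact m}) ⟩
    (w ⊗ qint (d + (b + b))) ⊗ qfact m            ≡⟨ cong (λ n → (w ⊗ qint n) ⊗ qfact m) eq ⟩
    (w ⊗ qint (suc m)) ⊗ qfact m
      ≈⟨ solve 3 (λ w i f → (w :* i) :* f := w :* (f :* i)) ≋-refl w (qint (suc m)) (qfact m) ⟩
    w ⊗ qfact (suc m)                             ∎
    where
    open ≋-Reasoning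
    open BallotIdentity d b using (ballot-identity; ballotD-identity)
    F = qfact (suc (d + b)) ⊗ qfact b
    u = qint (suc (d + b)) ⊗ (qpow b ⊗ qint d)
    v = qint b ⊗ (qpow (d + b) ⊗ (𝟙 ⊕ qpow b ⊗ qint (suc d)))
    w = qpow b ⊗ qint (suc d)

  ballotD-closed : ∀ m d b → d + (b + b) ≡ m →
    (qfact (suc (d + b)) ⊗ qfact b) ⊗ ballotD d b
      ≋ (qpow (d + b) ⊗ (𝟙 ⊕ qpow (suc b) ⊗ qint d)) ⊗ qfact m
  -- As lists the sides differ by a trailing zero, coming from the product with `qint 0 = []`; hence
  -- the comparison by coefficients.
  ballotD-closed zero    zero zero eq = mk≋ λ { zero → refl ; (suc zero) → refl ; (suc (suc i)) → refl }
  ballotD-closed (suc m) d    b    eq = begin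
    F ⊗ ballotD d b                               ≡⟨ cong (F ⊗_) (ballotD-rec d b eq) ⟩
    F ⊗ (ballotDn d b ⊕ N ⊗ ballotUp d b)
      ≈⟨ solve 4 (λ F x N y → F :* (x :+ N :* y) := F :* x :+ N :* (F :* y)) ≋-refl F (ballotDn d b) N (ballotUp d b) ⟩
    F ⊗ ballotDn d b ⊕ N ⊗ (F ⊗ ballotUp d b)
      ≈⟨ ⊕-≋-cong (ballotDn-closed m d b eq) (⊗-≋-cong (≋-refl {N}) (ballotUp-closed m d b eq)) ⟩
    v ⊗ qfact m ⊕ N ⊗ (u ⊗ qfact m)
      ≈⟨ solve 4 (λ v f N u → v :* f :+ N :* (u :* f) := (v :+ N :* u) :* f) ≋-refl v (qfact m) N u ⟩
    (v ⊕ N ⊗ u) ⊗ qfact m                         ≈⟨ ⊗-≋-cong ballotD-identity (≋-refl {qfact m}) ⟩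
    ((qpow (d + b) ⊗ (𝟙 ⊕ (q ⊗ qpow b) ⊗ qint d)) ⊗ qint (d + (b + b))) ⊗ qfact m
      ≈⟨ ⊗-≋-cong (⊗-≋-cong (⊗-≋-cong (≋-refl {qpow (d + b)}) (⊕-≋-cong (≋-refl {𝟙})
           (⊗-≋-cong (qpow-suc b) (≋-refl {qint d})))) (≋-refl {qint (d + (b + b))})) (≋-refl {qfact m}) ⟨
    (w ⊗ qint (d + (b + b))) ⊗ qfact m            ≡⟨ cong (λ n → (w ⊗ qint n) ⊗ qfact m) eq ⟩
    (w ⊗ qint (suc m)) ⊗ qfact m
      ≈⟨ solve 3 (λ w i f → (w :* i) :* f := w :* (f :* i)) ≋-refl w (qint (suc m)) (qfact m) ⟩
    w ⊗ qfact (suc m)                             ∎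
    where
    open ≋-Reasoning
    open BallotIdentity d b using (ballot-identity; ballotD-identity)
    F = qfact (suc (d + b)) ⊗ qfact b
    N = qpow (d + (b + b))
    u = qint (suc (d + b)) ⊗ (qpow b ⊗ qint d)
    v = qint b ⊗ (qpow (d + b) ⊗ (𝟙 ⊕ qpow b ⊗ qint (suc d)))
    w = qpow (d + b) ⊗ (𝟙 ⊕ qpow (suc b) ⊗ qint d)

  -- The factorials in front belong to the longer word, so induction leaves one q-integer over:
  -- [d+b+1] after deleting U, and [b] after deleting D in `ballotDn-closed`. Where no such letter
  -- can be deleted, the factor [d] or [b] on the right vanishes too.
  ballotUp-closed : ∀ m d b → d + (b + b) ≡ suc m →
    (qfact (suc (d + b)) ⊗ qfact b) ⊗ ballotUp d b
      ≋ (qint (suc (d + b)) ⊗ (qpow b ⊗ qint d)) ⊗ qfact m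
  ballotUp-closed m zero b eq = begin
    (qfact (suc b) ⊗ qfact b) ⊗ []           ≈⟨ ⊗-zeroʳ (qfact (suc b) ⊗ qfact b) ⟩
    []
      ≈⟨ solve 3 (λ x y z → (x :* (y :* con 0)) :* z := con 0) ≋-refl (qint (suc b)) (qpow b) (qfact m) ⟨
    (qint (suc b) ⊗ (qpow b ⊗ [])) ⊗ qfact m ∎
    where open ≋-Reasoning
  ballotUp-closed m (suc d) b eq = begin
    ((f ⊗ i) ⊗ qfact b) ⊗ ballot d b
      ≈⟨ solve 4 (λ f i g x → ((f :* i) :* g) :* x := i :* ((f :* g) :* x)) ≋-refl f i (qfact b) (ballot d b) ⟩
    i ⊗ ((f ⊗ qfact b) ⊗ ballot d b)
      ≈⟨ ⊗-≋-cong (≋-refl {i}) (ballot-closed m d b (ℕ.suc-injective eq)) ⟩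
    i ⊗ (w ⊗ qfact m)                        ≈⟨ ⊗-assoc i w (qfact m) ⟨
    (i ⊗ w) ⊗ qfact m                        ∎
    where
    open ≋-Reasoning
    f = qfact (suc d + b)
    i = qint (suc (suc d + b))
    w = qpow b ⊗ qint (suc d)

  ballotDn-closed : ∀ m d b → d + (b + b) ≡ suc m →
    (qfact (suc (d + b)) ⊗ qfact b) ⊗ ballotDn d b
      ≋ (qint b ⊗ (qpow (d + b) ⊗ (𝟙 ⊕ qpow b ⊗ qint (suc d)))) ⊗ qfact m
  ballotDn-closed m d zero    eq = ⊗-zeroʳ (qfact (suc (d + 0)) ⊗ 𝟙)
  ballotDn-closed m d (suc b) eq = begin
    (qfact (suc (d + suc b)) ⊗ (qfact b ⊗ i)) ⊗ ballotD (suc d) b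
      ≡⟨ cong (λ n → (qfact (suc n) ⊗ (qfact b ⊗ i)) ⊗ ballotD (suc d) b) (ℕ.+-suc d b) ⟩
    (f ⊗ (qfact b ⊗ i)) ⊗ ballotD (suc d) b
      ≈⟨ solve 4 (λ f g i x → (f :* (g :* i)) :* x := i :* ((f :* g) :* x)) ≋-refl f (qfact b) i (ballotD (suc d) b) ⟩
    i ⊗ ((f ⊗ qfact b) ⊗ ballotD (suc d) b)
      ≈⟨ ⊗-≋-cong (≋-refl {i}) (ballotD-closed m (suc d) b (length-dn d b eq)) ⟩
    i ⊗ ((qpow (suc d + b) ⊗ w) ⊗ qfact m)   ≈⟨ ⊗-assoc i (qpow (suc d + b) ⊗ w) (qfact m) ⟨
    (i ⊗ (qpow (suc d + b) ⊗ w)) ⊗ qfact m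
      ≡⟨ cong (λ n → (i ⊗ (qpow n ⊗ w)) ⊗ qfact m) (ℕ.+-suc d b) ⟨
    (i ⊗ (qpow (d + suc b) ⊗ w)) ⊗ qfact m   ∎
    where
    open ≋-Reasoning
    f = qfact (suc (suc d + b))
    i = qint (suc b)
    w = 𝟙 ⊕ qpow (suc b) ⊗ qint (suc d)

-- Generating functions of words

private variable
  X Y : Set

∑ : List X → (X → Poly) → Poly
∑ xs f = foldr (λ x s → f x ⊕ s) [] xs

-- An iterated sum and not a sum over a list of words, so that splitting off the head letter holds
-- by definition.
∑ʷ : ℕ → List X → (List X → Poly) → Poly
∑ʷ zero    xs F = F []
∑ʷ (suc m) xs F = ∑ xs λ x → ∑ʷ m xs λ w → F (x ∷ w)

infix 5 _?·_
_?·_ : Bool → Poly → Poly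
c ?· p = if c then p else []

∑-cong : ∀ (xs : List X) {f g} → (∀ x → f x ≡ g x) → ∑ xs f ≡ ∑ xs g
∑-cong []       e = refl
∑-cong (x ∷ xs) e = cong₂ _⊕_ (e x) (∑-cong xs e)

∑-zero : ∀ (xs : List X) → ∑ xs (λ _ → []) ≡ []
∑-zero []       = refl
∑-zero (x ∷ xs) = ∑-zero xs

∑ʷ-cong : ∀ m (xs : List X) {F G} → (∀ w → length w ≡ m → F w ≡ G w) → ∑ʷ m xs F ≡ ∑ʷ m xs G
∑ʷ-cong zero    xs e = e [] refl
∑ʷ-cong (suc m) xs e = ∑-cong xs λ x → ∑ʷ-cong m xs λ w l → e (x ∷ w) (cong suc l)

∑ʷ-zero : ∀ m (xs : List X) → ∑ʷ m xs (λ _ → []) ≡ []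
∑ʷ-zero zero    xs = refl
∑ʷ-zero (suc m) xs = trans (∑-cong xs λ _ → ∑ʷ-zero m xs) (∑-zero xs)

∑-⊗ : ∀ (xs : List X) {f g} p → (∀ x → f x ≋ p ⊗ g x) → ∑ xs f ≋ p ⊗ ∑ xs g
∑-⊗ []       {f} {g} p e = ≋-sym (⊗-zeroʳ p)
∑-⊗ (x ∷ xs) {f} {g} p e = ≋-trans (⊕-≋-cong (e x) (∑-⊗ xs p e)) (≋-sym (⊗-distribˡ p (g x) (∑ xs g)))

∑ʷ-⊗ : ∀ m (xs : List X) {F G} p → (∀ w → length w ≡ m → F w ≋ p ⊗ G w) → ∑ʷ m xs F ≋ p ⊗ ∑ʷ m xs G
∑ʷ-⊗ zero    xs p e = e [] refl
∑ʷ-⊗ (suc m) xs p e = ∑-⊗ xs p λ x → ∑ʷ-⊗ m xs p λ w l → e (x ∷ w) (cong suc l)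

-- A descent at the letter put in front of `w` has the same position `suc m` for all `w` of length
-- `m`, so its weight factors out.
∑ʷ-qpow : ∀ m (xs : List X) (c : List X → Bool) (e : List X → ℕ) →
  ∑ʷ m xs (λ w → c w ?· qpow (suc (length w) + e w)) ≋ qpow (suc m) ⊗ ∑ʷ m xs (λ w → c w ?· qpow (e w))
∑ʷ-qpow m xs c e = ∑ʷ-⊗ m xs (qpow (suc m)) lem
  where
  lem : ∀ w → length w ≡ m → (c w ?· qpow (suc (length w) + e w)) ≋ qpow (suc m) ⊗ (c w ?· qpow (e w))
  lem w refl with c w
  ... | true  = qpow-+ (suc (length w)) (e w)
  ... | false = ≋-sym (⊗-zeroʳ (qpow (suc (length w))))

-- The letter at value i records which rows of the array contain i: the top one (U), the bottom
-- one (D), both (B) or none (O).  The head of a word is the letter of the largest value.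
data Letter : Set where
  U B D O : Letter

letters : List Letter
letters = U ∷ B ∷ D ∷ O ∷ []

inTop inBot : Letter → Bool
inTop U = true
inTop B = true
inTop D = false
inTop O = false
inBot U = false
inBot B = true
inBot D = true
inBot O = false

-- w has d + b letters U, k letters B and b letters D, and every tail of w has at least as many
-- U as D; tails are the initial segments {1, …, i} of the values.
data Ok : ℕ → ℕ → ℕ → List Letter → Set where
  []   : Ok 0 0 0 []
  up   : ∀ {d k b w} → Ok d k b w → Ok (suc d) k b (U ∷ w)
  both : ∀ {d k b w} → Ok d k b w → Ok d (suc k) b (B ∷ w)
  down : ∀ {d k b w} → Ok (suc d) k b w → Ok d k (suc b) (D ∷ w)

ok? : ∀ w d k b → Dec (Ok d k b w)
ok? []      zero    zero    zero    = yes []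
ok? []      zero    zero    (suc b) = no λ ()
ok? []      zero    (suc k) b       = no λ ()
ok? []      (suc d) k       b       = no λ ()
ok? (U ∷ w) zero    k       b       = no λ ()
ok? (U ∷ w) (suc d) k       b       = map′ up (λ { (up p) → p }) (ok? w d k b)
ok? (B ∷ w) d       zero    b       = no λ ()
ok? (B ∷ w) d       (suc k) b       = map′ both (λ { (both p) → p }) (ok? w d k b)
ok? (D ∷ w) d       k       zero    = no λ ()
ok? (D ∷ w) d       k       (suc b) = map′ down (λ { (down p) → p }) (ok? w (suc d) k b)
ok? (O ∷ w) d       k       b       = no λ ()

-- The contribution of the position |w| when w is followed by a letter in the bottom row.
lastDescent : List Letter → ℕ
lastDescent []      = 0
lastDescent (l ∷ w) = if inTop l then suc (length w) else 0

wordMaj : List Letter → ℕ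
wordMaj []      = 0
wordMaj (l ∷ w) = (if inBot l then lastDescent w else 0) + wordMaj w

-- `wordGFᴰ` weights `w` as if a letter of the bottom row came next. Whether that letter is B or D
-- makes no difference to the descent, so both deletions lead to `wordGFᴰ`.
wordGF wordGFᴰ : ℕ → ℕ → ℕ → ℕ → Poly
wordGF  N d k b = ∑ʷ N letters λ w → does (ok? w d k b) ?· qpow (wordMaj w)
wordGFᴰ N d k b = ∑ʷ N letters λ w → does (ok? w d k b) ?· qpow (lastDescent w + wordMaj w)

wordUp wordBoth wordDown : ℕ → ℕ → ℕ → ℕ → Poly
wordUp N zero    k b = []
wordUp N (suc d) k b = wordGF N d k b
wordBoth N d zero    b = []
wordBoth N d (suc k) b = wordGFᴰ N d k b
wordDown N d k zero    = []
wordDown N d k (suc b) = wordGFᴰ N (suc d) k b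

wordGF-suc : ∀ N d k b → wordGF (suc N) d k b ≡ wordUp N d k b ⊕ (wordBoth N d k b ⊕ wordDown N d k b)
wordGF-suc N d k b = cong₂ _⊕_ (upEq d) (cong₂ _⊕_ (bothEq k)
  (trans (cong₂ _⊕_ (downEq b) (cong (_⊕ []) (∑ʷ-zero N letters))) (⊕-identityʳ (wordDown N d k b))))
  where
  upEq : ∀ d → ∑ʷ N letters (λ w → does (ok? (U ∷ w) d k b) ?· qpow (wordMaj (U ∷ w))) ≡ wordUp N d k b
  upEq zero    = ∑ʷ-zero N letters
  upEq (suc d) = refl
  bothEq : ∀ k → ∑ʷ N letters (λ w → does (ok? (B ∷ w) d k b) ?· qpow (wordMaj (B ∷ w))) ≡ wordBoth N d k b
  bothEq zero    = ∑ʷ-zero N letters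
  bothEq (suc k) = refl
  downEq : ∀ b → ∑ʷ N letters (λ w → does (ok? (D ∷ w) d k b) ?· qpow (wordMaj (D ∷ w))) ≡ wordDown N d k b
  downEq zero    = ∑ʷ-zero N letters
  downEq (suc b) = refl

-- A letter U or B followed by a bottom-row letter is a descent at `suc N`, whence the two powers; D
-- is none, and words with O are rejected by `ok?`.
wordGFᴰ-suc : ∀ N d k b → wordGFᴰ (suc N) d k b
  ≋ qpow (suc N) ⊗ wordUp N d k b ⊕ (qpow (suc N) ⊗ wordBoth N d k b ⊕ wordDown N d k b)
wordGFᴰ-suc N d k b = ⊕-≋-cong (upEq d) (⊕-≋-cong (bothEq k)
  (≋-trans (⊕-≋-cong (≡⇒≋ (downEq b)) (≡⇒≋ (cong (_⊕ []) (∑ʷ-zero N letters)))) (≡⇒≋ (⊕-identityʳ (wordDown N d k b)))))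
  where
  upEq : ∀ d → ∑ʷ N letters (λ w → does (ok? (U ∷ w) d k b) ?· qpow (lastDescent (U ∷ w) + wordMaj (U ∷ w)))
             ≋ qpow (suc N) ⊗ wordUp N d k b
  upEq zero    = ≋-trans (≡⇒≋ (∑ʷ-zero N letters)) (≋-sym (⊗-zeroʳ (qpow (suc N))))
  upEq (suc d) = ∑ʷ-qpow N letters (λ w → does (ok? w d k b)) wordMaj
  bothEq : ∀ k → ∑ʷ N letters (λ w → does (ok? (B ∷ w) d k b) ?· qpow (lastDescent (B ∷ w) + wordMaj (B ∷ w)))
               ≋ qpow (suc N) ⊗ wordBoth N d k b
  bothEq zero    = ≋-trans (≡⇒≋ (∑ʷ-zero N letters)) (≋-sym (⊗-zeroʳ (qpow (suc N))))
  bothEq (suc k) = ∑ʷ-qpow N letters (λ w → does (ok? w d k b)) (λ w → lastDescent w + wordMaj w)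
  downEq : ∀ b → ∑ʷ N letters (λ w → does (ok? (D ∷ w) d k b) ?· qpow (lastDescent (D ∷ w) + wordMaj (D ∷ w)))
               ≡ wordDown N d k b
  downEq zero    = ∑ʷ-zero N letters
  downEq (suc b) = refl

-- Solving the word recursions: insertion of the letters B

tri : ℕ → ℕ
tri zero    = 0
tri (suc k) = tri k + k

-- The q-binomial with upper parameter `i - 1`, set to zero at `i = 0`, so that `k = 0` needs no
-- separate Pascal rules.
qbin⁻ : ℕ → ℕ → Poly
qbin⁻ zero    j = []
qbin⁻ (suc i) j = qbin i j

qbin-zeroʳ : ∀ i → qbin i 0 ≡ 𝟙
qbin-zeroʳ zero    = refl
qbin-zeroʳ (suc i) = refl

qbin-sucʳ : ∀ i j → qbin i (suc j) ≋ qbin i j ⊕ qpow (suc j) ⊗ qbin⁻ i (suc j)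
qbin-sucʳ zero    j = ≋-sym (≋-trans (⊕-≋-cong (≋-refl {𝟙}) (⊗-zeroʳ (qpow (suc j)))) (≡⇒≋ refl))
qbin-sucʳ (suc i) j = ≋-refl

qbin-sucʳ′ : ∀ i j → qbin i (suc j) ≋ qpow i ⊗ qbin i j ⊕ qbin⁻ i (suc j)
qbin-sucʳ′ zero    j = ≡⇒≋ refl
qbin-sucʳ′ (suc i) j = qbin-pascal i j

mutual
  -- The letters B contribute a factor independent of the ballot word. Induction on the length
  -- verifies this by comparing the coefficients of `ballotUp d b` and `ballotDn d b`.
  wordGF-closed : ∀ N d k b → N ≡ k + (d + (b + b)) →
    wordGF N d k b ≋ (qpow (tri k) ⊗ qbin k (d + (b + b))) ⊗ ballot d b
  wordGF-closed zero    zero zero zero eq = ≡⇒≋ refl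
  wordGF-closed (suc N) d    k    b    eq = wordGF-closed-suc N d k b (d + (b + b)) refl eq

  wordGFᴰ-closed : ∀ N d k b → N ≡ k + (d + (b + b)) →
    wordGFᴰ N d k b ≋ (qpow (tri (suc k)) ⊗ qbin k (d + (b + b))) ⊗ ballotD d b
  wordGFᴰ-closed zero    zero zero zero eq = ≡⇒≋ refl
  wordGFᴰ-closed (suc N) d    k    b    eq = wordGFᴰ-closed-suc N d k b (d + (b + b)) refl eq

  wordUp-closed : ∀ N d k b m → d + (b + b) ≡ suc m → N ≡ k + m →
    wordUp N d k b ≋ (qpow (tri k) ⊗ qbin k m) ⊗ ballotUp d b
  wordUp-closed N zero    k b m em eN = ≋-sym (⊗-zeroʳ (qpow (tri k) ⊗ qbin k m))
  wordUp-closed N (suc d) k b m em eN with refl ← ℕ.suc-injective em = wordGF-closed N d k b eN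

  wordDown-closed : ∀ N d k b m → d + (b + b) ≡ suc m → N ≡ k + m →
    wordDown N d k b ≋ (qpow (tri (suc k)) ⊗ qbin k m) ⊗ ballotDn d b
  wordDown-closed N d k zero    m em eN = ≋-sym (⊗-zeroʳ (qpow (tri (suc k)) ⊗ qbin k m))
  wordDown-closed N d k (suc b) m em eN with refl ← length-dn d b em = wordGFᴰ-closed N (suc d) k b eN

  wordBoth-closed : ∀ N d k b m → d + (b + b) ≡ m → suc N ≡ k + m →
    wordBoth N d k b ≋ (qpow (tri k) ⊗ qbin⁻ k m) ⊗ ballotD d b
  wordBoth-closed N d zero    b m em   eN = ≋-sym (⊗-≋-cong (⊗-zeroʳ 𝟙) (≋-refl {ballotD d b}))
  wordBoth-closed N d (suc k) b m refl eN = wordGFᴰ-closed N d k b (ℕ.suc-injective eN)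

  -- Naming the ballot length `m` allows a case split on it: `m = 0` leaves only words in B, and for
  -- positive `m` the ballot recursions apply.
  wordGF-closed-suc : ∀ N d k b m → d + (b + b) ≡ m → suc N ≡ k + (d + (b + b)) →
    wordGF (suc N) d k b ≋ (qpow (tri k) ⊗ qbin k (d + (b + b))) ⊗ ballot d b
  wordGF-closed-suc N zero zero    zero zero em ()
  wordGF-closed-suc N zero (suc k) zero zero em eq = begin
    wordGF (suc N) 0 (suc k) 0                     ≡⟨ wordGF-suc N 0 (suc k) 0 ⟩
    wordBoth N 0 (suc k) 0 ⊕ []                    ≡⟨ ⊕-identityʳ (wordBoth N 0 (suc k) 0) ⟩
    wordBoth N 0 (suc k) 0                         ≈⟨ wordBoth-closed N 0 (suc k) 0 0 refl eq ⟩
    (qpow (tri (suc k)) ⊗ qbin k 0) ⊗ 𝟙            ≡⟨ cong (λ p → (qpow (tri (suc k)) ⊗ p) ⊗ 𝟙) (qbin-zeroʳ k) ⟩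
    (qpow (tri (suc k)) ⊗ 𝟙) ⊗ 𝟙                   ∎
    where open ≋-Reasoning
  wordGF-closed-suc N d k b (suc m) em eq = begin
    wordGF (suc N) d k b
      ≡⟨ wordGF-suc N d k b ⟩
    wordUp N d k b ⊕ (wordBoth N d k b ⊕ wordDown N d k b)
      ≈⟨ ⊕-≋-cong (wordUp-closed N d k b m em eN)
           (⊕-≋-cong (wordBoth-closed N d k b (suc m) em eq′) (wordDown-closed N d k b m em eN)) ⟩
    (t ⊗ p) ⊗ u ⊕ ((t ⊗ r) ⊗ ballotD d b ⊕ (qpow (tri k + k) ⊗ p) ⊗ v)
      -- The term from a last B carries `ballotD d b`; its recursion expresses it in `u` and `v`
      -- like the other two terms.
      ≈⟨ ⊕-≋-cong (≋-refl {(t ⊗ p) ⊗ u}) (⊕-≋-cong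
           (⊗-≋-cong (≋-refl {t ⊗ r}) (≡⇒≋ (trans (ballotD-rec d b em) (cong (λ n → v ⊕ qpow n ⊗ u) em))))
           (⊗-≋-cong (⊗-≋-cong (qpow-+ (tri k) k) (≋-refl {p})) (≋-refl {v}))) ⟩
    (t ⊗ p) ⊗ u ⊕ ((t ⊗ r) ⊗ (v ⊕ Q ⊗ u) ⊕ ((t ⊗ K) ⊗ p) ⊗ v)
      ≈⟨ solve 7 (λ t p u r v Q K → (t :* p) :* u :+ ((t :* r) :* (v :+ Q :* u) :+ ((t :* K) :* p) :* v)
           := (t :* (p :+ Q :* r)) :* u :+ (t :* (K :* p :+ r)) :* v) ≋-refl t p u r v Q K ⟩
    (t ⊗ (p ⊕ Q ⊗ r)) ⊗ u ⊕ (t ⊗ (K ⊗ p ⊕ r)) ⊗ v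
      -- The coefficient of `u` is one Pascal rule, that of `v` the other.
      ≈⟨ ⊕-≋-cong (⊗-≋-cong (⊗-≋-cong (≋-refl {t}) (qbin-sucʳ k m)) (≋-refl {u}))
                  (⊗-≋-cong (⊗-≋-cong (≋-refl {t}) (qbin-sucʳ′ k m)) (≋-refl {v})) ⟨
    (t ⊗ qbin k (suc m)) ⊗ u ⊕ (t ⊗ qbin k (suc m)) ⊗ v
      ≈⟨ ⊗-distribˡ (t ⊗ qbin k (suc m)) u v ⟨
    (t ⊗ qbin k (suc m)) ⊗ (u ⊕ v)
      ≡⟨ cong₂ (λ n s → (t ⊗ qbin k n) ⊗ s) em (ballot-rec d b em) ⟨
    (t ⊗ qbin k (d + (b + b))) ⊗ ballot d b ∎
    where
    open ≋-Reasoning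
    t = qpow (tri k)
    K = qpow k
    Q = qpow (suc m)
    p = qbin k m
    r = qbin⁻ k (suc m)
    u = ballotUp d b
    v = ballotDn d b
    eq′ = trans eq (cong (k +_) em)
    eN = ℕ.suc-injective (trans eq′ (ℕ.+-suc k m))

  wordGFᴰ-closed-suc : ∀ N d k b m → d + (b + b) ≡ m → suc N ≡ k + (d + (b + b)) →
    wordGFᴰ (suc N) d k b ≋ (qpow (tri (suc k)) ⊗ qbin k (d + (b + b))) ⊗ ballotD d b
  wordGFᴰ-closed-suc N zero zero    zero zero em ()
  wordGFᴰ-closed-suc N zero (suc k) zero zero em eq = begin
    wordGFᴰ (suc N) 0 (suc k) 0
      ≈⟨ wordGFᴰ-suc N 0 (suc k) 0 ⟩
    qpow (suc N) ⊗ [] ⊕ (qpow (suc N) ⊗ wordBoth N 0 (suc k) 0 ⊕ [])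
      ≈⟨ solve 2 (λ x y → x :* con 0 :+ (x :* y :+ con 0) := x :* y) ≋-refl (qpow (suc N)) (wordBoth N 0 (suc k) 0) ⟩
    qpow (suc N) ⊗ wordBoth N 0 (suc k) 0
      ≈⟨ ⊗-≋-cong (≋-refl {qpow (suc N)}) (wordBoth-closed N 0 (suc k) 0 0 refl eq) ⟩
    qpow (suc N) ⊗ ((t ⊗ qbin k 0) ⊗ 𝟙)
      -- The word consists of `suc k` letters B, so the new descent is at `suc k`, which raises
      -- `tri (suc k)` to `tri (suc (suc k))`.
      ≡⟨ cong₂ (λ n p → qpow n ⊗ ((t ⊗ p) ⊗ 𝟙)) (trans eq (ℕ.+-identityʳ (suc k))) (qbin-zeroʳ k) ⟩
    qpow (suc k) ⊗ ((t ⊗ 𝟙) ⊗ 𝟙)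
      ≈⟨ solve 2 (λ x t → x :* ((t :* con 1) :* con 1) := ((t :* x) :* con 1) :* con 1) ≋-refl (qpow (suc k)) t ⟩
    ((t ⊗ qpow (suc k)) ⊗ 𝟙) ⊗ 𝟙
      ≈⟨ ⊗-≋-cong (⊗-≋-cong (qpow-+ (tri (suc k)) (suc k)) (≋-refl {𝟙})) (≋-refl {𝟙}) ⟨
    (qpow (tri (suc (suc k))) ⊗ 𝟙) ⊗ 𝟙 ∎
    where
    open ≋-Reasoning
    t = qpow (tri (suc k))
  wordGFᴰ-closed-suc N d k b (suc m) em eq = begin
    wordGFᴰ (suc N) d k b
      ≈⟨ wordGFᴰ-suc N d k b ⟩
    qpow (suc N) ⊗ wordUp N d k b ⊕ (qpow (suc N) ⊗ wordBoth N d k b ⊕ wordDown N d k b)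
      ≈⟨ ⊕-≋-cong (⊗-≋-cong N≋ (wordUp-closed N d k b m em eN)) (⊕-≋-cong
           (⊗-≋-cong N≋ (wordBoth-closed N d k b (suc m) em eq′))
           (≋-trans (wordDown-closed N d k b m em eN) (⊗-≋-cong (⊗-≋-cong (qpow-+ (tri k) k) (≋-refl {p})) (≋-refl {v})))) ⟩
    (K ⊗ Q) ⊗ ((t ⊗ p) ⊗ u) ⊕ ((K ⊗ Q) ⊗ ((t ⊗ r) ⊗ h) ⊕ ((t ⊗ K) ⊗ p) ⊗ v)
      ≈⟨ solve 8 (λ t p u r v Q K h →
              (K :* Q) :* ((t :* p) :* u) :+ ((K :* Q) :* ((t :* r) :* h) :+ ((t :* K) :* p) :* v)
           := ((t :* K) :* p) :* (v :+ Q :* u) :+ ((t :* K) :* (Q :* r)) :* h) ≋-refl t p u r v Q K h ⟩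
    ((t ⊗ K) ⊗ p) ⊗ (v ⊕ Q ⊗ u) ⊕ ((t ⊗ K) ⊗ (Q ⊗ r)) ⊗ h
      -- Here the U and D terms reassemble to `ballotD d b` themselves, so a single Pascal rule
      -- suffices.
      ≡⟨ cong (λ s → ((t ⊗ K) ⊗ p) ⊗ s ⊕ ((t ⊗ K) ⊗ (Q ⊗ r)) ⊗ h)
           (trans (ballotD-rec d b em) (cong (λ n → v ⊕ qpow n ⊗ u) em)) ⟨
    ((t ⊗ K) ⊗ p) ⊗ h ⊕ ((t ⊗ K) ⊗ (Q ⊗ r)) ⊗ h
      ≈⟨ solve 4 (λ s p r h → (s :* p) :* h :+ (s :* r) :* h := (s :* (p :+ r)) :* h) ≋-refl (t ⊗ K) p (Q ⊗ r) h ⟩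
    ((t ⊗ K) ⊗ (p ⊕ Q ⊗ r)) ⊗ h
      ≈⟨ ⊗-≋-cong (⊗-≋-cong (qpow-+ (tri k) k) (qbin-sucʳ k m)) (≋-refl {h}) ⟨
    (qpow (tri (suc k)) ⊗ qbin k (suc m)) ⊗ h
      ≡⟨ cong (λ n → (qpow (tri (suc k)) ⊗ qbin k n) ⊗ h) em ⟨
    (qpow (tri (suc k)) ⊗ qbin k (d + (b + b))) ⊗ h ∎
    where
    open ≋-Reasoning
    t = qpow (tri k)
    K = qpow k
    Q = qpow (suc m)
    p = qbin k m
    r = qbin⁻ k (suc m)
    u = ballotUp d b
    v = ballotDn d b
    h = ballotD d b
    eq′ = trans eq (cong (k +_) em)
    eN = ℕ.suc-injective (trans eq′ (ℕ.+-suc k m))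
    N≋ : qpow (suc N) ≋ K ⊗ Q
    N≋ = ≋-trans (≡⇒≋ (cong qpow eq′)) (qpow-+ k (suc m))

-- Rearranging sums over sequences

⊕-interchange : ∀ a b c d → (a ⊕ b) ⊕ (c ⊕ d) ≡ (a ⊕ c) ⊕ (b ⊕ d)
⊕-interchange a b c d = begin
  (a ⊕ b) ⊕ (c ⊕ d) ≡⟨ ⊕-assoc a b (c ⊕ d) ⟩
  a ⊕ (b ⊕ (c ⊕ d)) ≡⟨ cong (a ⊕_) (⊕-assoc b c d) ⟨
  a ⊕ ((b ⊕ c) ⊕ d) ≡⟨ cong (λ s → a ⊕ (s ⊕ d)) (⊕-comm b c) ⟩
  a ⊕ ((c ⊕ b) ⊕ d) ≡⟨ cong (a ⊕_) (⊕-assoc c b d) ⟩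
  a ⊕ (c ⊕ (b ⊕ d)) ≡⟨ ⊕-assoc a c (b ⊕ d) ⟨
  (a ⊕ c) ⊕ (b ⊕ d) ∎
  where open ≡-Reasoning

∑-cong-∈ : ∀ (xs : List X) {f g} → (∀ {x} → x ∈ xs → f x ≡ g x) → ∑ xs f ≡ ∑ xs g
∑-cong-∈ []       e = refl
∑-cong-∈ (x ∷ xs) e = cong₂ _⊕_ (e (here refl)) (∑-cong-∈ xs (e ∘ there))

∑-⊕ : ∀ (xs : List X) f g → ∑ xs (λ x → f x ⊕ g x) ≡ ∑ xs f ⊕ ∑ xs g
∑-⊕ []       f g = refl
∑-⊕ (x ∷ xs) f g = trans (cong ((f x ⊕ g x) ⊕_) (∑-⊕ xs f g)) (⊕-interchange (f x) (g x) (∑ xs f) (∑ xs g))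

∑-swap : ∀ (xs : List X) (ys : List Y) (f : X → Y → Poly) →
         ∑ xs (λ x → ∑ ys (f x)) ≡ ∑ ys (λ y → ∑ xs λ x → f x y)
∑-swap []       ys f = sym (∑-zero ys)
∑-swap (x ∷ xs) ys f = trans (cong (∑ ys (f x) ⊕_) (∑-swap xs ys f)) (sym (∑-⊕ ys (f x) _))

∑-++ : ∀ (xs ys : List X) f → ∑ (xs ++ ys) f ≡ ∑ xs f ⊕ ∑ ys f
∑-++ []       ys f = refl
∑-++ (x ∷ xs) ys f = trans (cong (f x ⊕_) (∑-++ xs ys f)) (sym (⊕-assoc (f x) (∑ xs f) (∑ ys f)))

∑-map : ∀ (h : X → Y) xs f → ∑ (map h xs) f ≡ ∑ xs (f ∘ h)
∑-map h []       f = refl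
∑-map h (x ∷ xs) f = cong (f (h x) ⊕_) (∑-map h xs f)

∑-concatMap : ∀ (h : X → List Y) xs f → ∑ (concatMap h xs) f ≡ ∑ xs λ x → ∑ (h x) f
∑-concatMap h []       f = refl
∑-concatMap h (x ∷ xs) f = trans (∑-++ (h x) (concatMap h xs) f) (cong (∑ (h x) f ⊕_) (∑-concatMap h xs f))

∑-filter : ∀ {P : Pred X 0ℓ} (P? : Decidable P) xs f → ∑ (filter P? xs) f ≡ ∑ xs λ x → does (P? x) ?· f x
∑-filter P? []       f = refl
∑-filter P? (x ∷ xs) f with does (P? x)
... | true  = cong (f x ⊕_) (∑-filter P? xs f)
... | false = ∑-filter P? xs f

∑-↭ : ∀ {xs ys : List X} f → xs ↭ ys → ∑ xs f ≡ ∑ ys f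
∑-↭ f ↭.refl        = refl
∑-↭ f (↭.prep x p)  = cong (f x ⊕_) (∑-↭ f p)
∑-↭ f (↭.swap {xs} {ys} x y p) = begin
  f x ⊕ (f y ⊕ ∑ xs f) ≡⟨ ⊕-assoc (f x) (f y) (∑ xs f) ⟨
  (f x ⊕ f y) ⊕ ∑ xs f ≡⟨ cong₂ _⊕_ (⊕-comm (f x) (f y)) (∑-↭ f p) ⟩
  (f y ⊕ f x) ⊕ ∑ ys f ≡⟨ ⊕-assoc (f y) (f x) (∑ ys f) ⟩
  f y ⊕ (f x ⊕ ∑ ys f) ∎
  where open ≡-Reasoning
∑-↭ f (↭.trans p r) = trans (∑-↭ f p) (∑-↭ f r)

∑ʷ-⊕ : ∀ m (xs : List X) F G → ∑ʷ m xs (λ w → F w ⊕ G w) ≡ ∑ʷ m xs F ⊕ ∑ʷ m xs G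
∑ʷ-⊕ zero    xs F G = refl
∑ʷ-⊕ (suc m) xs F G = trans (∑-cong xs λ x → ∑ʷ-⊕ m xs (F ∘ (x ∷_)) (G ∘ (x ∷_))) (∑-⊕ xs _ _)

∑ʷ-?· : ∀ m (xs : List X) c F → (c ?· ∑ʷ m xs F) ≡ ∑ʷ m xs λ w → c ?· F w
∑ʷ-?· m xs true  F = refl
∑ʷ-?· m xs false F = sym (∑ʷ-zero m xs)

∑ʷ-↭ : ∀ m {xs ys : List X} F → xs ↭ ys → ∑ʷ m xs F ≡ ∑ʷ m ys F
∑ʷ-↭ zero    F p = refl
∑ʷ-↭ (suc m) {xs} F p = trans (∑-cong xs λ x → ∑ʷ-↭ m (F ∘ (x ∷_)) p) (∑-↭ _ p)

∑ʷ-∷ʳ : ∀ m (xs : List X) F → ∑ʷ (suc m) xs F ≡ ∑ xs λ x → ∑ʷ m xs λ w → F (w ∷ʳ x)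
∑ʷ-∷ʳ zero    xs F = refl
∑ʷ-∷ʳ (suc m) xs F = trans (∑-cong xs λ x → ∑ʷ-∷ʳ m xs (F ∘ (x ∷_)))
                           (∑-swap xs xs λ x y → ∑ʷ m xs λ w → F (x ∷ (w ∷ʳ y)))

∑ʷ-reverse : ∀ m (xs : List X) F → ∑ʷ m xs (F ∘ reverse) ≡ ∑ʷ m xs F
∑ʷ-reverse zero    xs F = refl
∑ʷ-reverse (suc m) xs F = begin
  (∑ xs λ x → ∑ʷ m xs λ w → F (reverse (x ∷ w)))
    ≡⟨ ∑-cong xs (λ x → ∑ʷ-cong m xs λ w _ → cong F (unfold-reverse x w)) ⟩
  (∑ xs λ x → ∑ʷ m xs λ w → F (reverse w ∷ʳ x))
    ≡⟨ ∑-cong xs (λ x → ∑ʷ-reverse m xs (F ∘ (_∷ʳ x))) ⟩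
  (∑ xs λ x → ∑ʷ m xs λ w → F (w ∷ʳ x))
    ≡⟨ ∑ʷ-∷ʳ m xs F ⟨
  ∑ʷ (suc m) xs F ∎
  where open ≡-Reasoning

-- The summand sees `f` only through `tabulate f`, which avoids function extensionality.
∑-allFuns : ∀ m vs F → ∑ (allFuns m vs) (λ f → F (tabulate f)) ≡ ∑ʷ m vs F
∑-allFuns zero    vs F = ⊕-identityʳ (F [])
∑-allFuns (suc m) vs F = trans (∑-concatMap _ vs _)
  (∑-cong vs λ v → trans (∑-map _ (allFuns m vs) _) (∑-allFuns m vs (F ∘ (v ∷_))))

∑ʷ-drop : ∀ m (x : X) xs F → (∀ w → x ∈ w → F w ≡ []) → ∑ʷ m (x ∷ xs) F ≡ ∑ʷ m xs F
∑ʷ-drop zero    x xs F v = refl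
∑ʷ-drop (suc m) x xs F v = cong₂ _⊕_
  (trans (∑ʷ-cong m (x ∷ xs) λ w _ → v (x ∷ w) (here refl)) (∑ʷ-zero m (x ∷ xs)))
  (∑-cong xs λ y → ∑ʷ-drop m x xs (F ∘ (y ∷_)) λ w i → v (y ∷ w) (there i))

-- Decreasing sequences as subsets, pairs of subsets as words

range : ℕ → List ℕ
range N = map suc (downFrom N)

range-↭ : ∀ N → map suc (upTo N) ↭ range N
range-↭ N = map⁺ suc (↭-trans (↭-sym (↭-reverse (upTo N))) (↭-reflexive (reverse-upTo N)))

bools : List Bool
bools = true ∷ false ∷ []

-- The argument is the indicator word of a set of values, with the largest value at the head as in
-- words of letters.
positions : List Bool → List ℕ
positions []          = []
positions (true  ∷ w) = suc (length w) ∷ positions w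
positions (false ∷ w) = positions w

-- A strictly decreasing sequence is a subset of the values. The induction on `N` asks whether the
-- largest value is in it; if so, it is the first entry.
∑ʷ-decreasing : ∀ m N F → (∀ w → ¬ AllPairs _>_ w → F w ≡ []) →
  ∑ʷ m (range N) F ≡ ∑ʷ N bools λ u → (length (positions u) ≡ᵇ m) ?· F (positions u)
∑ʷ-decreasing zero    zero    F v = refl
∑ʷ-decreasing (suc m) zero    F v = refl
∑ʷ-decreasing zero    (suc N) F v = sym (cong₂ _⊕_ (∑ʷ-zero N bools)
  (trans (⊕-identityʳ _) (sym (∑ʷ-decreasing zero N F v))))
∑ʷ-decreasing (suc m) (suc N) F v = cong₂ _⊕_
  (begin
    ∑ʷ m (range (suc N)) (F ∘ (suc N ∷_))
      -- After the head `suc N` this value cannot recur.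
      ≡⟨ ∑ʷ-drop m (suc N) (range N) _ (λ w i → v _ λ { (p ∷ _) → ℕ.<-irrefl refl (All.lookup p i) }) ⟩
    ∑ʷ m (range N) (F ∘ (suc N ∷_))
      ≡⟨ ∑ʷ-decreasing m N _ (λ w n → v _ λ { (_ ∷ p) → n p }) ⟩
    ∑ʷ N bools (λ u → (length (positions u) ≡ᵇ m) ?· F (suc N ∷ positions u))
      ≡⟨ ∑ʷ-cong N bools (λ u l → cong (λ n → (length (positions u) ≡ᵇ m) ?· F (suc n ∷ positions u)) (sym l)) ⟩
    ∑ʷ N bools (λ u → (length (positions u) ≡ᵇ m) ?· F (suc (length u) ∷ positions u)) ∎)
  (begin
    ∑ (range N) (λ x → ∑ʷ m (range (suc N)) (F ∘ (x ∷_)))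
      -- A head at most `N` rules out `suc N` further on.
      ≡⟨ ∑-cong-∈ (range N) (λ {x} x∈ → ∑ʷ-drop m (suc N) (range N) _
           λ w i → v _ λ { (p ∷ _) → ℕ.<-asym (All.lookup p i) (s≤s (range-≤ x∈)) }) ⟩
    ∑ʷ (suc m) (range N) F
      ≡⟨ ∑ʷ-decreasing (suc m) N F v ⟩
    ∑ʷ N bools (λ u → (length (positions u) ≡ᵇ suc m) ?· F (positions u))
      ≡⟨ ⊕-identityʳ _ ⟨
    _ ∎)
  where
  open ≡-Reasoning
  range-≤ : ∀ {x} → x ∈ range N → x ≤ N
  range-≤ x∈ with _ , i∈ , refl ← ∈-map⁻ suc x∈ = ∈-downFrom⁻ i∈

-- The two membership bits of a value form one letter. The order of summation differs from `letters`
-- only in U and B.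
∑ʷ-letters : ∀ N (F : List Bool → List Bool → Poly) →
  ∑ʷ N bools (λ u → ∑ʷ N bools (F u)) ≡ ∑ʷ N letters λ w → F (map inTop w) (map inBot w)
∑ʷ-letters zero    F = refl
∑ʷ-letters (suc N) F = begin
  ∑ʷ N bools (λ u → ∑ʷ (suc N) bools (F (true ∷ u))) ⊕ (∑ʷ N bools (λ u → ∑ʷ (suc N) bools (F (false ∷ u))) ⊕ [])
    ≡⟨ cong₂ _⊕_ (split true) (trans (⊕-identityʳ _) (split false)) ⟩
  (S B ⊕ S U) ⊕ (S D ⊕ S O)
    ≡⟨ cong (_⊕ (S D ⊕ S O)) (⊕-comm (S B) (S U)) ⟩
  (S U ⊕ S B) ⊕ (S D ⊕ S O)
    ≡⟨ ⊕-assoc (S U) (S B) (S D ⊕ S O) ⟩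
  S U ⊕ (S B ⊕ (S D ⊕ S O))
    ≡⟨ cong (λ s → S U ⊕ (S B ⊕ (S D ⊕ s))) (⊕-identityʳ (S O)) ⟨
  S U ⊕ (S B ⊕ (S D ⊕ (S O ⊕ []))) ∎
  where
  open ≡-Reasoning
  S : Letter → Poly
  S l = ∑ʷ N letters λ w → F (inTop l ∷ map inTop w) (inBot l ∷ map inBot w)
  S′ : Bool → Bool → Poly
  S′ c c′ = ∑ʷ N letters λ w → F (c ∷ map inTop w) (c′ ∷ map inBot w)
  split : ∀ c → ∑ʷ N bools (λ u → ∑ʷ (suc N) bools (F (c ∷ u))) ≡ S′ c true ⊕ S′ c false
  split c = begin
    ∑ʷ N bools (λ u → ∑ʷ N bools (λ w → F (c ∷ u) (true ∷ w)) ⊕ (∑ʷ N bools (λ w → F (c ∷ u) (false ∷ w)) ⊕ []))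
      ≡⟨ ∑ʷ-cong N bools (λ u _ → cong (∑ʷ N bools (λ w → F (c ∷ u) (true ∷ w)) ⊕_) (⊕-identityʳ _)) ⟩
    ∑ʷ N bools (λ u → ∑ʷ N bools (λ w → F (c ∷ u) (true ∷ w)) ⊕ ∑ʷ N bools (λ w → F (c ∷ u) (false ∷ w)))
      ≡⟨ ∑ʷ-⊕ N bools _ _ ⟩
    ∑ʷ N bools (λ u → ∑ʷ N bools (λ w → F (c ∷ u) (true ∷ w))) ⊕ ∑ʷ N bools (λ u → ∑ʷ N bools (λ w → F (c ∷ u) (false ∷ w)))
      ≡⟨ cong₂ _⊕_ (∑ʷ-letters N λ u w → F (c ∷ u) (true ∷ w)) (∑ʷ-letters N λ u w → F (c ∷ u) (false ∷ w)) ⟩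
    S′ c true ⊕ S′ c false ∎

-- Arrays and words

length-∷ʳ : ∀ (xs : List X) {x} → length (xs ∷ʳ x) ≡ suc (length xs)
length-∷ʳ xs = trans (length-++ xs) (ℕ.+-comm (length xs) 1)

AllPairs-reverse : ∀ {R : Rel X 0ℓ} {xs} → AllPairs R xs → AllPairs (flip R) (reverse xs)
AllPairs-reverse []               = []
AllPairs-reverse {xs = x ∷ xs} (p ∷ ps) = subst (AllPairs _) (sym (unfold-reverse x xs))
  (AllPairs.++⁺ (AllPairs-reverse ps) ([] ∷ [])
    (All-resp-↭ (↭-sym (↭-reverse xs)) (All.map (_∷ []) p)))

AllPairs-tabulate⁻ : ∀ {R : Rel X 0ℓ} {n} {f : Fin n → X} → AllPairs R (tabulate f) →
                     ∀ {i j} → i F.< j → R (f i) (f j)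
AllPairs-tabulate⁻ (p ∷ ps) {F.zero}  {F.suc j} i<j       = All.tabulate⁻ p j
AllPairs-tabulate⁻ (p ∷ ps) {F.suc i} {F.suc j} (s≤s i<j) = AllPairs-tabulate⁻ ps i<j

-- The defining conditions on an array in terms of its rows read from right to left; this order
-- makes them decreasing, as `positions` produces them.
Good : ℕ → List ℕ → List ℕ → Set
Good N s t = AllPairs _>_ s × AllPairs _>_ t × Pointwise _≤_ s t
  × All (λ x → 1 ≤ x × x ≤ N) s × All (λ x → 1 ≤ x × x ≤ N) t
  × (∀ (x : Fin N) → suc (toℕ x) ∈ s ⊎ suc (toℕ x) ∈ t)

good? : ∀ N s t → Dec (Good N s t)
good? N s t = allPairs? _>?_ s ×-dec allPairs? _>?_ t ×-dec Pointwise.decidable _≤?_ s t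
  ×-dec All.all? (λ x → (1 ≤? x) ×-dec (x ≤? N)) s ×-dec All.all? (λ x → (1 ≤? x) ×-dec (x ≤? N)) t
  ×-dec all? (λ x → (suc (toℕ x) ∈? s) ⊎-dec (suc (toℕ x) ∈? t))

descent : List ℕ → List ℕ → ℕ → ℕ
descent s t i = if does ((i ∈? s) ×-dec (suc i ∈? t)) then i else 0

listMaj : ℕ → List ℕ → List ℕ → ℕ
listMaj N s t = sum (map (descent s t) (range N))

row : ∀ {n} → (Fin n → ℕ) → List ℕ
row f = reverse (tabulate f)

∈-row⁺ : ∀ {n} (f : Fin n → ℕ) j → f j ∈ row f
∈-row⁺ f j = Any.reverse⁺ (∈-tabulate⁺ {f = f} j)

∈-row⁻ : ∀ {n} (f : Fin n → ℕ) {x} → x ∈ row f → ∃[ j ] f j ≡ x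
∈-row⁻ f x∈ with j , e ← ∈-tabulate⁻ {f = f} (Any.reverse⁻ x∈) = j , sym e

row-increasing : ∀ {n} (f : Fin n → ℕ) → (∀ j j' → j F.< j' → f j < f j') ⇔ AllPairs _>_ (row f)
row-increasing f = mk⇔
  (λ inc → AllPairs-reverse (AllPairs.tabulate⁺-< λ {i} {j} → inc i j))
  (λ p j j' → AllPairs-tabulate⁻ (subst (AllPairs _<_) (reverse-involutive (tabulate f)) (AllPairs-reverse p)))

row-All : ∀ {n} (f : Fin n → ℕ) {P : Pred ℕ 0ℓ} → (∀ j → P (f j)) ⇔ All P (row f)
row-All f = mk⇔
  (λ h → All-resp-↭ (↭-sym (↭-reverse (tabulate f))) (All.tabulate⁺ h))
  (λ p → All.tabulate⁻ (All-resp-↭ (↭-reverse (tabulate f)) p))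

row-Pointwise : ∀ {n} (f g : Fin n → ℕ) → (∀ j → f j ≤ g j) ⇔ Pointwise _≤_ (row f) (row g)
row-Pointwise f g = mk⇔
  (λ h → Pointwise.reverse⁺ (Pointwise.tabulate⁺ h))
  (λ p → Pointwise.tabulate⁻ (subst₂ (Pointwise _≤_) (reverse-involutive (tabulate f)) (reverse-involutive (tabulate g))
           (Pointwise.reverse⁺ p)))

isRInc⇔good : ∀ n k (T : Array n) → IsRInc n k T ⇔ Good (2 * n ∸ k) (row (T row1)) (row (T row2))
isRInc⇔good n k T = mk⇔
  (λ (inc , col , rng , cov) →
      to (row-increasing s) (inc row1) , to (row-increasing t) (inc row2) , to (row-Pointwise s t) col
    , to (row-All s) (rng row1) , to (row-All t) (rng row2)
    , λ x → cover (cov x))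
  (λ (ds , dt , col , rs , rt , cov) →
      (λ { F.zero → from (row-increasing s) ds ; (F.suc F.zero) → from (row-increasing t) dt })
    , from (row-Pointwise s t) col
    , (λ { F.zero → from (row-All s) rs ; (F.suc F.zero) → from (row-All t) rt })
    , λ x → uncover (cov x))
  where
  open Equivalence using (to; from)
  s = T row1
  t = T row2
  cover : ∀ {y} → ∃[ r ] ∃[ j ] T r j ≡ y → y ∈ row s ⊎ y ∈ row t
  cover (F.zero       , j , refl) = inj₁ (∈-row⁺ s j)
  cover (F.suc F.zero , j , refl) = inj₂ (∈-row⁺ t j)
  uncover : ∀ {y} → y ∈ row s ⊎ y ∈ row t → ∃[ r ] ∃[ j ] T r j ≡ y
  uncover (inj₁ y∈) = row1 , ∈-row⁻ s y∈
  uncover (inj₂ y∈) = row2 , ∈-row⁻ t y∈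

foldr-+≡sum-map : ∀ (f : ℕ → ℕ) xs → foldr (λ i s → f i + s) 0 xs ≡ sum (map f xs)
foldr-+≡sum-map f []       = refl
foldr-+≡sum-map f (x ∷ xs) = cong (f x +_) (foldr-+≡sum-map f xs)

maj≡listMaj : ∀ n k (T : Array n) → maj n k T ≡ listMaj (2 * n ∸ k) (row (T row1)) (row (T row2))
maj≡listMaj n k T = begin
  maj n k T                                     ≡⟨ foldr-+≡sum-map δ (map suc (upTo N)) ⟩
  sum (map δ (map suc (upTo N)))                ≡⟨ sum-↭ (map⁺ δ (range-↭ N)) ⟩
  sum (map δ (range N))                         ≡⟨ cong sum (map-cong δ≡ (range N)) ⟩
  listMaj N (row (T row1)) (row (T row2))       ∎
  where
  open ≡-Reasoning
  N = 2 * n ∸ k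
  δ : ℕ → ℕ
  δ i = if does (isDescent? T i) then i else 0
  δ≡ : ∀ i → δ i ≡ descent (row (T row1)) (row (T row2)) i
  δ≡ i = cong (if_then i else 0) (does-⇔ (mk⇔
    (λ { ((j , refl) , (j' , e)) → ∈-row⁺ (T row1) j , subst (_∈ row (T row2)) e (∈-row⁺ (T row2) j') })
    (λ { (i∈ , i∈') → ∈-row⁻ (T row1) i∈ , ∈-row⁻ (T row2) i∈' }))
    (isDescent? T i) ((i ∈? row (T row1)) ×-dec (suc i ∈? row (T row2))))

-- Rows and major index read off a word

positions-bounds : ∀ u → All (λ x → 1 ≤ x × x ≤ length u) (positions u)
positions-bounds []          = []
positions-bounds (true  ∷ u) = (s≤s z≤n , ℕ.≤-refl) ∷ All.map (λ (l , h) → l , ℕ.m≤n⇒m≤1+n h) (positions-bounds u)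
positions-bounds (false ∷ u) = All.map (λ (l , h) → l , ℕ.m≤n⇒m≤1+n h) (positions-bounds u)

positions-decreasing : ∀ u → AllPairs _>_ (positions u)
positions-decreasing []          = []
positions-decreasing (true  ∷ u) = All.map (λ (_ , h) → s≤s h) (positions-bounds u) ∷ positions-decreasing u
positions-decreasing (false ∷ u) = positions-decreasing u

∈-positions-≤ : ∀ {i} u → i ∈ positions u → i ≤ length u
∈-positions-≤ u i∈ = proj₂ (All.lookup (positions-bounds u) i∈)

∈-positions-∷⁺ : ∀ {i} c u → i ∈ positions u → i ∈ positions (c ∷ u)
∈-positions-∷⁺ true  u i∈ = there i∈
∈-positions-∷⁺ false u i∈ = i∈

∈-positions-∷⁻ : ∀ {i} c u → i ≤ length u → i ∈ positions (c ∷ u) → i ∈ positions u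
∈-positions-∷⁻ true  u i≤ (here refl) = ⊥-elim (ℕ.<-irrefl refl i≤)
∈-positions-∷⁻ true  u i≤ (there i∈)  = i∈
∈-positions-∷⁻ false u i≤ i∈          = i∈

topRow botRow : List Letter → List ℕ
topRow w = positions (map inTop w)
botRow w = positions (map inBot w)

length-top : ∀ w → length (map inTop w) ≡ length w
length-top = length-map inTop

length-bot : ∀ w → length (map inBot w) ≡ length w
length-bot = length-map inBot

descent-≡0 : ∀ s t i → ¬ (i ∈ s × suc i ∈ t) → descent s t i ≡ 0
descent-≡0 s t i n = cong (if_then i else 0) (dec-false ((i ∈? s) ×-dec (suc i ∈? t)) n)

-- The value `suc (length w)` exceeds all entries.
descent-last : ∀ w → descent (topRow w) (botRow w) (length w) ≡ 0
descent-last w = descent-≡0 (topRow w) (botRow w) (length w) λ (_ , i∈) →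
  ℕ.<-irrefl refl (subst (length w <_) (length-bot w) (∈-positions-≤ (map inBot w) i∈))

-- Both `i` and `suc i` are at most `length w`, and the new letter only concerns the value
-- `suc (length w)`.
descent-∷ : ∀ l w i → suc i ≤ length w →
  descent (topRow (l ∷ w)) (botRow (l ∷ w)) i ≡ descent (topRow w) (botRow w) i
descent-∷ l w i i< = cong (if_then i else 0) (does-⇔ (mk⇔
  (λ (a , b) → ∈-positions-∷⁻ (inTop l) (map inTop w) (ℕ.<⇒≤ (subst (i <_) (sym (length-top w)) i<)) a
             , ∈-positions-∷⁻ (inBot l) (map inBot w) (subst (i <_) (sym (length-bot w)) i<) b)
  (λ (a , b) → ∈-positions-∷⁺ (inTop l) (map inTop w) a , ∈-positions-∷⁺ (inBot l) (map inBot w) b))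
  ((i ∈? topRow (l ∷ w)) ×-dec (suc i ∈? botRow (l ∷ w))) ((i ∈? topRow w) ×-dec (suc i ∈? botRow w)))

∉-positions-head : ∀ u → suc (length u) ∉ positions (false ∷ u)
∉-positions-head u i∈ = ℕ.<-irrefl refl (∈-positions-≤ u i∈)

-- Only two bits decide: the bottom bit `c′` of the largest value and the top bit `a` of the one
-- below it.
descent-head : ∀ c a u c′ a′ v → length u ≡ length v →
  descent (positions (c ∷ a ∷ u)) (positions (c′ ∷ a′ ∷ v)) (suc (length u))
    ≡ (if c′ then (if a then suc (length u) else 0) else 0)
descent-head c a u false a′ v e = descent-≡0 (positions (c ∷ a ∷ u)) (positions (a′ ∷ v)) (suc (length u))
  λ (_ , i∈) → ∉-positions-head (a′ ∷ v) (subst (λ n → suc (suc n) ∈ positions (a′ ∷ v)) e i∈)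
descent-head c false u true a′ v e = descent-≡0 (positions (c ∷ false ∷ u)) (positions (true ∷ a′ ∷ v)) (suc (length u))
  λ (i∈ , _) → ∉-positions-head u (∈-positions-∷⁻ c (false ∷ u) ℕ.≤-refl i∈)
descent-head c true u true a′ v e = cong (if_then suc (length u) else 0)
  (dec-true ((suc (length u) ∈? positions (c ∷ true ∷ u)) ×-dec (suc (suc (length u)) ∈? positions (true ∷ a′ ∷ v)))
    (∈-positions-∷⁺ c (true ∷ u) (here refl) , here (cong (suc ∘ suc) e)))

sum-descent-∷ : ∀ l w n → suc n ≤ length w →
  listMaj n (topRow (l ∷ w)) (botRow (l ∷ w)) ≡ listMaj n (topRow w) (botRow w)
sum-descent-∷ l w zero    n< = refl
sum-descent-∷ l w (suc n) n< = cong₂ _+_ (descent-∷ l w (suc n) n<) (sum-descent-∷ l w n (ℕ.<⇒≤ n<))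

wordMaj≡listMaj : ∀ w → listMaj (length w) (topRow w) (botRow w) ≡ wordMaj w
wordMaj≡listMaj []          = refl
wordMaj≡listMaj (l ∷ [])    = trans (cong (_+ 0) (descent-last (l ∷ []))) (if-0 (inBot l))
  where
  if-0 : ∀ c → 0 ≡ (if c then 0 else 0) + 0
  if-0 true  = refl
  if-0 false = refl
wordMaj≡listMaj (l ∷ l′ ∷ w) = begin
  descent s t (suc (suc n)) + (descent s t (suc n) + listMaj n s t)
    ≡⟨ cong (_+ (descent s t (suc n) + listMaj n s t)) (descent-last (l ∷ l′ ∷ w)) ⟩
  descent s t (suc n) + listMaj n s t
    ≡⟨ cong₂ _+_ head (sum-descent-∷ l (l′ ∷ w) n ℕ.≤-refl) ⟩
  h + listMaj n (topRow (l′ ∷ w)) (botRow (l′ ∷ w))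
    -- The zero term for the largest value of the tail is put back, to give the sum in the induction
    -- hypothesis.
    ≡⟨ cong (λ z → h + (z + listMaj n (topRow (l′ ∷ w)) (botRow (l′ ∷ w)))) (descent-last (l′ ∷ w)) ⟨
  h + listMaj (suc n) (topRow (l′ ∷ w)) (botRow (l′ ∷ w))
    ≡⟨ cong (h +_) (wordMaj≡listMaj (l′ ∷ w)) ⟩
  wordMaj (l ∷ l′ ∷ w) ∎
  where
  open ≡-Reasoning
  n = length w
  s = topRow (l ∷ l′ ∷ w)
  t = botRow (l ∷ l′ ∷ w)
  h = if inBot l then lastDescent (l′ ∷ w) else 0
  head : descent s t (suc n) ≡ h
  head = subst (λ m → descent s t (suc m) ≡ (if inBot l then (if inTop l′ then suc m else 0) else 0)) (length-top w)
    (descent-head (inTop l) (inTop l′) (map inTop w) (inBot l) (inBot l′) (map inBot w)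
      (trans (length-top w) (sym (length-bot w))))

-- Column condition and ballot condition

Covered : List Letter → Set
Covered w = ∀ i → i < length w → suc i ∈ topRow w ⊎ suc i ∈ botRow w

covered-tail : ∀ l w → Covered (l ∷ w) → Covered w
covered-tail l w cov i i< with cov i (ℕ.m≤n⇒m≤1+n i<)
... | inj₁ a = inj₁ (∈-positions-∷⁻ (inTop l) (map inTop w) (subst (i <_) (sym (length-top w)) i<) a)
... | inj₂ b = inj₂ (∈-positions-∷⁻ (inBot l) (map inBot w) (subst (i <_) (sym (length-bot w)) i<) b)

covered-∷ : ∀ l w → suc (length w) ∈ topRow (l ∷ w) ⊎ suc (length w) ∈ botRow (l ∷ w) → Covered w → Covered (l ∷ w)
covered-∷ l w h cov i (s≤s i≤) with ℕ.m≤n⇒m<n∨m≡n i≤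
... | inj₂ refl = h
... | inj₁ i< with cov i i<
...   | inj₁ a = inj₁ (∈-positions-∷⁺ (inTop l) (map inTop w) a)
...   | inj₂ b = inj₂ (∈-positions-∷⁺ (inBot l) (map inBot w) b)

top-head : ∀ w → suc (length w) ∈ positions (true ∷ map inTop w)
top-head w = here (cong suc (sym (length-top w)))

bot-head : ∀ w → suc (length w) ∈ positions (true ∷ map inBot w)
bot-head w = here (cong suc (sym (length-bot w)))

ok⇒covered : ∀ {d k b w} → Ok d k b w → Covered w
ok⇒covered [] i ()
ok⇒covered {w = _ ∷ w} (up o)   = covered-∷ U w (inj₁ (top-head w)) (ok⇒covered o)
ok⇒covered {w = _ ∷ w} (both o) = covered-∷ B w (inj₁ (top-head w)) (ok⇒covered o)
ok⇒covered {w = _ ∷ w} (down o) = covered-∷ D w (inj₂ (bot-head w)) (ok⇒covered o)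

-- Reading a word from the largest value down, pending holds the bottom entries still to be
-- matched with a top entry; the column condition says that this queue is never popped when empty.
columns⇒ok : ∀ w pending → All (length w <_) pending → Covered w →
  Pointwise _≤_ (topRow w) (pending ++ botRow w) → ∃₂ λ k b → Ok (length pending) k b w
columns⇒ok [] [] big cov p = 0 , 0 , []
-- With an empty queue this top entry would need a partner among the bottom entries of `w`, which
-- are all smaller.
columns⇒ok (U ∷ w) [] big cov p = ⊥-elim (absurd (map inBot w) (length-bot w) p)
  where
  absurd : ∀ v {xs} → length v ≡ length w → ¬ Pointwise _≤_ (suc (length (map inTop w)) ∷ xs) (positions v)
  absurd v e p with positions v | positions-bounds v
  absurd v e (h ∷ _) | y ∷ ys | (_ , y≤) ∷ _ =
    ℕ.<-irrefl (trans (length-top w) (sym e)) (ℕ.≤-trans h y≤)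
columns⇒ok (U ∷ w) (x ∷ xs) (_ ∷ big) cov (_ ∷ p)
  with k , b , o ← columns⇒ok w xs (All.map ℕ.<⇒≤ big) (covered-tail U w cov) p = k , b , up o
columns⇒ok (B ∷ w) [] big cov (_ ∷ p)
  with k , b , o ← columns⇒ok w [] [] (covered-tail B w cov) p = suc k , b , both o
-- The top entry takes the oldest pending one and the bottom entry joins the end, so the queue keeps
-- its length.
columns⇒ok (B ∷ w) (x ∷ xs) (_ ∷ big) cov (_ ∷ p)
  with k , b , o ← columns⇒ok w (xs ∷ʳ suc (length (map inBot w)))
    (All.∷ʳ⁺ (All.map ℕ.<⇒≤ big) (s≤s (ℕ.≤-reflexive (sym (length-bot w))))) (covered-tail B w cov)
    (subst (Pointwise _≤_ (topRow w)) (sym (++-assoc xs _ (botRow w))) p)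
  = suc k , b , both (subst (λ d → Ok d k b w) (length-∷ʳ xs) o)
columns⇒ok (D ∷ w) xs big cov p
  with k , b , o ← columns⇒ok w (xs ∷ʳ suc (length (map inBot w)))
    (All.∷ʳ⁺ (All.map ℕ.<⇒≤ big) (s≤s (ℕ.≤-reflexive (sym (length-bot w))))) (covered-tail D w cov)
    (subst (Pointwise _≤_ (topRow w)) (sym (++-assoc xs _ (botRow w))) p)
  = k , suc b , down (subst (λ d → Ok d k b w) (length-∷ʳ xs) o)
columns⇒ok (O ∷ w) xs big cov p with cov (length w) ℕ.≤-refl
... | inj₁ a = ⊥-elim (ℕ.<-irrefl refl (subst (length w <_) (length-top w) (∈-positions-≤ (map inTop w) a)))
... | inj₂ b = ⊥-elim (ℕ.<-irrefl refl (subst (length w <_) (length-bot w) (∈-positions-≤ (map inBot w) b)))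

-- Pending entries exceed every value still to be read, so each match satisfies the column
-- condition; the index `d` is the length of the queue, hence there is always an entry to match a U.
ok⇒columns : ∀ {d k b w} → Ok d k b w → ∀ pending → length pending ≡ d → All (length w <_) pending →
  Pointwise _≤_ (topRow w) (pending ++ botRow w)
ok⇒columns [] [] e big = []
ok⇒columns {w = _ ∷ w} (up o) (x ∷ xs) e (h ∷ big) =
  ℕ.<⇒≤ (subst (λ n → suc n < x) (sym (length-top w)) h)
  ∷ ok⇒columns o xs (ℕ.suc-injective e) (All.map ℕ.<⇒≤ big)
ok⇒columns {w = _ ∷ w} (both o) [] e big =
  ℕ.≤-reflexive (cong suc (trans (length-top w) (sym (length-bot w)))) ∷ ok⇒columns o [] e []
ok⇒columns {w = _ ∷ w} (both o) (x ∷ xs) e (h ∷ big) =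
  ℕ.<⇒≤ (subst (λ n → suc n < x) (sym (length-top w)) h)
  ∷ subst (Pointwise _≤_ (topRow w)) (++-assoc xs _ (botRow w))
      (ok⇒columns o (xs ∷ʳ suc (length (map inBot w))) (trans (length-∷ʳ xs) e)
        (All.∷ʳ⁺ (All.map ℕ.<⇒≤ big) (s≤s (ℕ.≤-reflexive (sym (length-bot w))))))
ok⇒columns {w = _ ∷ w} (down o) xs e big =
  subst (Pointwise _≤_ (topRow w)) (++-assoc xs _ (botRow w))
    (ok⇒columns o (xs ∷ʳ suc (length (map inBot w))) (trans (length-∷ʳ xs) (cong suc e))
      (All.∷ʳ⁺ (All.map ℕ.<⇒≤ big) (s≤s (ℕ.≤-reflexive (sym (length-bot w))))))

ok-length : ∀ {d k b w} → Ok d k b w → length w ≡ k + (d + (b + b))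
ok-length [] = refl
ok-length {suc d} {k} {b} (up o) = trans (cong suc (ok-length o)) (sym (ℕ.+-suc k (d + (b + b))))
ok-length (both o) = cong suc (ok-length o)
ok-length {d} {k} {suc b} (down o) = trans (cong suc (ok-length o)) (arith d k b)
  where
  arith : ∀ d k b → suc (k + (suc d + (b + b))) ≡ k + (d + (suc b + suc b))
  arith = solve-∀

ok-top : ∀ {d k b w} → Ok d k b w → length (topRow w) ≡ k + (d + b)
ok-top [] = refl
ok-top {suc d} {k} {b} (up o) = trans (cong suc (ok-top o)) (sym (ℕ.+-suc k (d + b)))
ok-top (both o) = cong suc (ok-top o)
ok-top {d} {k} {suc b} (down o) = trans (ok-top o) (cong (k +_) (sym (ℕ.+-suc d b)))

ok-bot : ∀ {d k b w} → Ok d k b w → length (botRow w) ≡ k + b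
ok-bot [] = refl
ok-bot (up o) = ok-bot o
ok-bot (both o) = cong suc (ok-bot o)
ok-bot {k = k} {suc b} (down o) = trans (cong suc (ok-bot o)) (sym (ℕ.+-suc k b))

-- Twice the first equation minus the second gives `k′ = k`; the bound on `k` makes the truncated
-- subtraction exact.
counts-unique : ∀ n k k′ b → k ≤ n → k′ + b ≡ n → k′ + (b + b) ≡ 2 * n ∸ k → k′ ≡ k × b ≡ n ∸ k
counts-unique n k k′ b k≤n refl e = k′≡k , trans (sym (ℕ.m+n∸m≡n k′ b)) (cong (k′ + b ∸_) k′≡k)
  where
  k≤2n : k ≤ 2 * (k′ + b)
  k≤2n = ℕ.≤-trans k≤n (ℕ.m≤m+n (k′ + b) _)
  arith : ∀ k b → 2 * (k + b) ≡ k + (k + (b + b))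
  arith = solve-∀
  k′≡k : k′ ≡ k
  k′≡k = ℕ.+-cancelʳ-≡ (k′ + (b + b)) k′ k
    (sym (trans (cong (k +_) e) (trans (ℕ.m+[n∸m]≡n k≤2n) (arith k′ b))))

-- The empty queue at the start gives `d = 0`; the numbers of letters B and D are then forced by the
-- row length and the word length.
good⇔ok : ∀ n k w → k ≤ n → length w ≡ 2 * n ∸ k →
  (length (topRow w) ≡ n × length (botRow w) ≡ n × Good (2 * n ∸ k) (topRow w) (botRow w)) ⇔ Ok 0 k (n ∸ k) w
good⇔ok n k w k≤n e = mk⇔ to from
  where
  N = 2 * n ∸ k
  to : _ → Ok 0 k (n ∸ k) w
  to (top≡ , _ , _ , _ , col , _ , _ , cov)
    with k′ , b , o ← columns⇒ok w [] [] (λ i i< → subst (λ j → suc j ∈ topRow w ⊎ suc j ∈ botRow w)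
                        (toℕ-fromℕ< (subst (i <_) e i<)) (cov (fromℕ< (subst (i <_) e i<)))) col
    with refl , refl ← counts-unique n k k′ b k≤n (trans (sym (ok-top o)) top≡) (trans (sym (ok-length o)) e) = o
  bounds : ∀ u → length u ≡ length w → All (λ x → 1 ≤ x × x ≤ N) (positions u)
  bounds u l = subst (λ n → All (λ x → 1 ≤ x × x ≤ n) (positions u)) (trans l e) (positions-bounds u)
  from : Ok 0 k (n ∸ k) w → _
  from o = trans (ok-top o) (ℕ.m+[n∸m]≡n k≤n) , trans (ok-bot o) (ℕ.m+[n∸m]≡n k≤n)
    , positions-decreasing (map inTop w) , positions-decreasing (map inBot w) , ok⇒columns o [] refl []
    , bounds (map inTop w) (length-top w) , bounds (map inBot w) (length-bot w)
    , λ x → ok⇒covered o (toℕ x) (subst (toℕ x <_) (sym e) (toℕ<n x))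

-- From the sum over arrays to the sum over words

module _ (n k : ℕ) (k≤n : k ≤ n) where
  open ≡-Reasoning
  private
    N = 2 * n ∸ k

    V : List ℕ → List ℕ → Poly
    V s t = does (good? N s t) ?· qpow (listMaj N s t)

    weight≡V : ∀ (T : Array n) → (does (isRInc? n k T) ?· qpow (maj n k T)) ≡ V (row (T row1)) (row (T row2))
    weight≡V T = cong₂ (λ c e → c ?· qpow e)
      (does-⇔ (isRInc⇔good n k T) (isRInc? n k T) (good? N (row (T row1)) (row (T row2)))) (maj≡listMaj n k T)

    V-vanish : ∀ s t → ¬ Good N s t → V s t ≡ []
    V-vanish s t ¬g = cong (_?· qpow (listMaj N s t)) (dec-false (good? N s t) ¬g)

    ∑-rows : ∀ F → ∑ (allFuns n (map suc (upTo N))) (F ∘ row) ≡ ∑ʷ n (range N) F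
    ∑-rows F = begin
      ∑ (allFuns n (map suc (upTo N))) (F ∘ row) ≡⟨ ∑-allFuns n (map suc (upTo N)) (F ∘ reverse) ⟩
      ∑ʷ n (map suc (upTo N)) (F ∘ reverse)      ≡⟨ ∑ʷ-reverse n (map suc (upTo N)) F ⟩
      ∑ʷ n (map suc (upTo N)) F                  ≡⟨ ∑ʷ-↭ n F (range-↭ N) ⟩
      ∑ʷ n (range N) F                           ∎

    ∑-allArrays : ∀ W (G : List ℕ → List ℕ → Poly) → (∀ T → W T ≡ G (row (T row1)) (row (T row2))) →
      ∑ (allArrays n N) W ≡ ∑ʷ n (range N) λ s → ∑ʷ n (range N) (G s)
    ∑-allArrays W G W≡G = begin
      ∑ (allArrays n N) W
        ≡⟨ ∑-concatMap _ rows W ⟩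
      ∑ rows (λ a → ∑ (map _ rows) W)
        ≡⟨ ∑-cong rows (λ a → trans (∑-map _ rows W) (∑-cong rows λ b → W≡G _)) ⟩
      ∑ rows (λ a → ∑ rows (λ b → G (row a) (row b)))
        ≡⟨ ∑-cong rows (λ a → ∑-rows (G (row a))) ⟩
      ∑ rows (λ a → ∑ʷ n (range N) (G (row a)))
        ≡⟨ ∑-rows (λ s → ∑ʷ n (range N) (G s)) ⟩
      ∑ʷ n (range N) (λ s → ∑ʷ n (range N) (G s)) ∎
      where rows = allFuns n (map suc (upTo N))

    len : List Bool → Bool
    len u = length (positions u) ≡ᵇ n

    ?·-∧ : ∀ a b c p → ((a ∧ b ∧ c) ?· p) ≡ (a ?· (b ?· (c ?· p)))
    ?·-∧ false b     c p = refl
    ?·-∧ true  false c p = refl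
    ?·-∧ true  true  c p = refl

    word-weight : ∀ w → length w ≡ N →
      (len (map inTop w) ?· (len (map inBot w) ?· V (topRow w) (botRow w)))
        ≡ (does (ok? w 0 k (n ∸ k)) ?· qpow (wordMaj w))
    word-weight w e = begin
      (len (map inTop w) ?· (len (map inBot w) ?· V (topRow w) (botRow w)))
        ≡⟨ ?·-∧ (len (map inTop w)) (len (map inBot w)) _ _ ⟨
      (len (map inTop w) ∧ len (map inBot w) ∧ does (good? N (topRow w) (botRow w)) ?· qpow (listMaj N (topRow w) (botRow w)))
        -- The conjunction of the three guards is what `does` of the nested `×-dec` computes to, as
        -- `_≟_` decides by `_≡ᵇ_`.
        ≡⟨ cong₂ (λ c m → c ?· qpow m)
             (does-⇔ (good⇔ok n k w k≤n e)
               ((length (topRow w) ≟ n) ×-dec (length (botRow w) ≟ n) ×-dec good? N (topRow w) (botRow w)) (ok? w 0 k (n ∸ k)))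
             (trans (cong (λ m → listMaj m (topRow w) (botRow w)) (sym e)) (wordMaj≡listMaj w)) ⟩
      (does (ok? w 0 k (n ∸ k)) ?· qpow (wordMaj w)) ∎

  majGF≡wordGF : majGF n k ≡ wordGF (2 * n ∸ k) 0 k (n ∸ k)
  majGF≡wordGF = begin
    ∑ (RInc n k) (λ T → qpow (maj n k T))
      ≡⟨ ∑-filter (isRInc? n k) (allArrays n N) _ ⟩
    ∑ (allArrays n N) (λ T → does (isRInc? n k T) ?· qpow (maj n k T))
      ≡⟨ ∑-allArrays _ V weight≡V ⟩
    ∑ʷ n (range N) (λ s → ∑ʷ n (range N) (V s))
      -- For a top row that is not decreasing every inner summand vanishes, since `Good` fails.
      ≡⟨ ∑ʷ-decreasing n N _ (λ s ¬d → trans (∑ʷ-cong n (range N) λ t _ → V-vanish s t λ g → ¬d (proj₁ g)) (∑ʷ-zero n (range N))) ⟩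
    ∑ʷ N bools (λ u → len u ?· ∑ʷ n (range N) (V (positions u)))
      ≡⟨ ∑ʷ-cong N bools (λ u _ → cong (len u ?·_) (∑ʷ-decreasing n N _ λ t ¬d → V-vanish (positions u) t λ g → ¬d (proj₁ (proj₂ g)))) ⟩
    ∑ʷ N bools (λ u → len u ?· ∑ʷ N bools (λ v → len v ?· V (positions u) (positions v)))
      ≡⟨ ∑ʷ-cong N bools (λ u _ → ∑ʷ-?· N bools (len u) _) ⟩
    ∑ʷ N bools (λ u → ∑ʷ N bools (λ v → len u ?· (len v ?· V (positions u) (positions v))))
      ≡⟨ ∑ʷ-letters N _ ⟩
    ∑ʷ N letters (λ w → len (map inTop w) ?· (len (map inBot w) ?· V (topRow w) (botRow w)))
      ≡⟨ ∑ʷ-cong N letters word-weight ⟩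
    wordGF N 0 k (n ∸ k) ∎

-- Exponents and the final formula

tri-double : ∀ k → tri k + tri k + k ≡ k * k
tri-double zero    = refl
tri-double (suc k) = trans (arith₁ (tri k) k) (trans (cong (λ s → suc (k + k + s)) (tri-double k)) (arith₂ k))
  where
  arith₁ : ∀ t k → t + k + (t + k) + suc k ≡ suc (k + k + (t + t + k))
  arith₁ = solve-∀
  arith₂ : ∀ k → suc (k + k + k * k) ≡ suc k * suc k
  arith₂ = solve-∀

module Exponents (k m : ℕ) where
  2n≡ : ∀ k m → 2 * (k + m) ≡ k + (k + (m + m))
  2n≡ = solve-∀

  2n∸k : 2 * (k + m) ∸ k ≡ k + (m + m)
  2n∸k = trans (cong (_∸ k) (2n≡ k m)) (ℕ.m+n∸m≡n k (k + (m + m)))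

  2n∸k∸k : 2 * (k + m) ∸ k ∸ k ≡ m + m
  2n∸k∸k = trans (cong (_∸ k) 2n∸k) (ℕ.m+n∸m≡n k (m + m))

  2n∸2k : 2 * (k + m) ∸ 2 * k ≡ m + m
  2n∸2k = trans (cong (_∸ 2 * k) (lem k m)) (ℕ.m+n∸m≡n (2 * k) (m + m))
    where
    lem : ∀ k m → 2 * (k + m) ≡ 2 * k + (m + m)
    lem = solve-∀

  -- With `n = k + m` the numerator before subtraction is `3 * k` plus an even number, so both the
  -- truncated subtraction and the halving are exact.
  expo≡ : expo (k + m) k ≡ tri k + m
  expo≡ = trans (cong (λ e → (e ∸ 3 * k) / 2) num)
                (trans (cong (_/ 2) (ℕ.m+n∸m≡n (3 * k) ((tri k + m) * 2))) (m*n/n≡m (tri k + m) 2))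
    where
    lem : ∀ k m t → 2 * (k + m) + (t + t + k) ≡ 3 * k + (t + m) * 2
    lem = solve-∀
    num : 2 * (k + m) + k * k ≡ 3 * k + (tri k + m) * 2
    num = trans (cong (2 * (k + m) +_) (sym (tri-double k))) (lem k m (tri k))

closed-form : ∀ k m → qint (suc m) ⊗ (qfact k ⊗ qfact (m + m)) ⊗ (qfact m ⊗ qfact m) ⊗ wordGF (k + (m + m)) 0 k m
  ≋ qpow (tri k + m) ⊗ qfact (k + (m + m)) ⊗ qfact (m + m)
closed-form k m = begin
  i ⊗ (fk ⊗ f2m) ⊗ (fm ⊗ fm) ⊗ wordGF (k + (m + m)) 0 k m
    ≈⟨ ⊗-≋-cong (≋-refl {i ⊗ (fk ⊗ f2m) ⊗ (fm ⊗ fm)}) (wordGF-closed (k + (m + m)) 0 k m refl) ⟩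
  i ⊗ (fk ⊗ f2m) ⊗ (fm ⊗ fm) ⊗ ((t ⊗ p) ⊗ g)
    -- The factor `i` joins one `fm` to form `qfact (suc m)`, the factorial that `ballot-closed`
    -- needs at `d = 0`.
    ≈⟨ solve 7 (λ i fk f2m fm t p g → i :* (fk :* f2m) :* (fm :* fm) :* ((t :* p) :* g)
         := t :* ((fk :* f2m) :* p) :* (((fm :* i) :* fm) :* g)) ≋-refl i fk f2m fm t p g ⟩
  t ⊗ ((fk ⊗ f2m) ⊗ p) ⊗ (((fm ⊗ i) ⊗ fm) ⊗ g)
    ≈⟨ ⊗-≋-cong (⊗-≋-cong (≋-refl {t}) (qfact-qbin k (m + m))) (ballot-closed (m + m) 0 m refl) ⟩
  t ⊗ qfact (k + (m + m)) ⊗ ((qpow m ⊗ 𝟙) ⊗ f2m)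
    ≈⟨ solve 4 (λ t f Q g → t :* f :* ((Q :* con 1) :* g) := (t :* Q) :* f :* g) ≋-refl t (qfact (k + (m + m))) (qpow m) f2m ⟩
  (t ⊗ qpow m) ⊗ qfact (k + (m + m)) ⊗ f2m
    ≈⟨ ⊗-≋-cong (⊗-≋-cong (qpow-+ (tri k) m) (≋-refl {qfact (k + (m + m))})) (≋-refl {f2m}) ⟨
  qpow (tri k + m) ⊗ qfact (k + (m + m)) ⊗ f2m ∎
  where
  open ≋-Reasoning
  i   = qint (suc m)
  fk  = qfact k
  f2m = qfact (m + m)
  fm  = qfact m
  t   = qpow (tri k)
  p   = qbin k (m + m)
  g   = ballot 0 m

theorem1p3 : (n k : ℕ) → 1 ≤ n → k ≤ n →
    qint (n ∸ k + 1) ⊗ (qfact k ⊗ qfact (2 * n ∸ k ∸ k)) ⊗ (qfact (n ∸ k) ⊗ qfact (2 * n ∸ 2 * k ∸ (n ∸ k))) ⊗ majGF n k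
    ≈ₚ qpow (expo n k) ⊗ qfact (2 * n ∸ k) ⊗ qfact (2 * n ∸ 2 * k)
-- Putting `n = k + m` evaluates all truncated subtractions. The double one `2n∸k∸k` is rewritten
-- before `2n∸k`, which would destroy its left side.
theorem1p3 n k _ k≤n with m , refl ← ℕ.m≤n⇒∃[o]m+o≡n k≤n
  rewrite majGF≡wordGF (k + m) k k≤n | ℕ.m+n∸m≡n k m | Exponents.2n∸2k k m | Exponents.2n∸k∸k k m
        | Exponents.2n∸k k m | Exponents.expo≡ k m | ℕ.m+n∸m≡n m m | ℕ.+-comm m 1
  = coeff≡ (closed-form k m)
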